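{- Let $\mu(0),\mu(1),\mu(2),\dots$ be independent indeterminates over $\mathbb{Q}$, and let $\nu(i)=\mu(i+1)$ for all $i\ge 0$. Then for all integers $m\ge 0$ and $n\ge 1$, the following identity holds in the field of rational functions $\mathbb{Q}(\mu(0),\mu(1),\dots)$: \[ \det\left(D_j(\mu;0,i+m)\right)_{i,j=0}^{n-1} = D_0(\mu;0,m)\cdot \det\left(D_j(\nu;0,i+m)\right)_{i,j=0}^{n-2}\cdot\prod_{i=1}^{n-1}\frac{D_{i+m}(\mu;0,i+m)}{D_{i+m}(\mu;1,i+m)}. \]
   Context: For a sequence $\mu=(\mu(k))_{k\ge0}$ and integers $0\le a\le j\le b$, $D_j(\mu;a,b)$ denotes the determinant of the $(b-a)\times(b-a)$ matrix \[ \begin{pmatrix} \mu(a) & \cdots & \mu(j-1) & \mu(j+1) & \cdots & \mu(b) \\ \vdots & \ddots & \vdots & \vdots & \ddots & \vdots \\ \mu(b-1) & \cdots & \mu(j+b-a-2) & \mu(j+b-a) & \cdots & \mu(2b-a-1) \end{pmatrix}, \] that is, the matrix whose row $r$ ($0\le r\le b-a-1$) has entries $\mu(c+r)$, with $c$ running in increasing order over $\{a,a+1,\dots,b\}\setminus\{j\}$. For $0\le a\le b$ and $j<a$ or $j>b$, set $D_j(\mu;a,b)=0$. The same notation is used with $\nu$ in place of $\mu$. The determinant of an empty ($0\times0$) matrix and an empty product are both $1$. When the $\mu(k)$ are indeterminates and $a\le j\le b$, $D_j(\mu;a,b)$ is not the zero polynomial, so the denominators in the identity are nonzero. -}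

module Defs where

open import Algebra.Bundles using (CommutativeRing; CommutativeSemiring)
open import Data.Bool using (Bool; true; false; T; if_then_else_; _∧_)
open import Data.Empty using (⊥-elim)
open import Data.Fin using (Fin; toℕ; fromℕ; inject₁; punchIn) renaming (zero to fzero; suc to fsuc)
import Data.Fin.Properties as Fin
open import Data.Nat using (ℕ; zero; suc; _∸_; _≤_; _<_; z≤n; s≤s; _<ᵇ_; _≤ᵇ_; _⊔_; _≟_)
import Data.Nat as ℕ
import Data.Nat.Properties as ℕ
open import Data.Product using (∃; _,_; _×_; proj₁; proj₂)
open import Data.Rational using (ℚ; 0ℚ; 1ℚ)
import Data.Rational as ℚ
import Data.Rational.Properties as ℚ
import Relation.Binary.Reasoning.Setoid
open import Data.Sum using (_⊎_; inj₁; inj₂; [_,_]′; map₁; map₂)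
open import Level using (0ℓ)
open import Relation.Binary.PropositionalEquality as ≡ using (_≡_; _≢_)
open import Relation.Nullary using (¬_; yes; no)

skip : ℕ → ℕ → ℕ
skip j k = if k <ᵇ j then k else suc k

module Determinants {c ℓ} (R : CommutativeRing c ℓ) where

  open CommutativeRing R
  open import Algebra.Properties.Semiring.Sum semiring using (sum)
  open import Algebra.Properties.Semiring.Exp semiring using (_^_)

  Matrix : ℕ → Set c
  Matrix n = Fin n → Fin n → Carrier

  det : ∀ {n} → Matrix n → Carrier
  det {zero}  A = 1#
  det {suc n} A =
    sum λ c → (- 1#) ^ toℕ c * (A fzero c * det λ r d → A (fsuc r) (punchIn c d))

  -- The k-th column of the matrix (k = 0, …, b − a − 1) starts with the k-th
  -- element of {a, …, b} ∖ {j}, which is skip j (a + k).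
  D : (ℕ → Carrier) → (a b j : ℕ) → Carrier
  D μ a b j =
    if (a ≤ᵇ j) ∧ (j ≤ᵇ b)
    then (det {b ∸ a} λ r k → μ (skip j (a ℕ.+ toℕ k) ℕ.+ toℕ r))
    else 0#

-- The polynomial ring ℚ[x₀, x₁, …], as the free commutative ℚ-algebra on
-- the variables: ring expressions modulo the least congruence that contains
-- the commutative ring laws and makes con a ring homomorphism.

infixl 6 _:+_
infixl 7 _:*_
infix  8 :-_
infix  4 _≋_ _≉_

data Poly : Set where
  con       : ℚ → Poly
  var       : ℕ → Poly
  _:+_ _:*_ : Poly → Poly → Poly
  :-_       : Poly → Poly

data _≋_ : Poly → Poly → Set where
  ≋-refl     : ∀ {p} → p ≋ p
  ≋-sym      : ∀ {p q} → p ≋ q → q ≋ p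
  ≋-trans    : ∀ {p q r} → p ≋ q → q ≋ r → p ≋ r
  +-cong     : ∀ {p p′ q q′} → p ≋ p′ → q ≋ q′ → p :+ q ≋ p′ :+ q′
  *-cong     : ∀ {p p′ q q′} → p ≋ p′ → q ≋ q′ → p :* q ≋ p′ :* q′
  neg-cong   : ∀ {p p′} → p ≋ p′ → :- p ≋ :- p′
  +-assoc    : ∀ p q r → (p :+ q) :+ r ≋ p :+ (q :+ r)
  +-comm     : ∀ p q → p :+ q ≋ q :+ p
  +-identity : ∀ p → con 0ℚ :+ p ≋ p
  +-inverse  : ∀ p → :- p :+ p ≋ con 0ℚ
  *-assoc    : ∀ p q r → (p :* q) :* r ≋ p :* (q :* r)
  *-comm     : ∀ p q → p :* q ≋ q :* p
  *-identity : ∀ p → con 1ℚ :* p ≋ p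
  distrib    : ∀ p q r → (q :+ r) :* p ≋ q :* p :+ r :* p
  con-+      : ∀ a b → con (a ℚ.+ b) ≋ con a :+ con b
  con-*      : ∀ a b → con (a ℚ.* b) ≋ con a :* con b

_≉_ : Poly → Poly → Set
p ≉ q = ¬ p ≋ q

ℚ[x] : CommutativeRing 0ℓ 0ℓ
ℚ[x] = record
  { Carrier = Poly ; _≈_ = _≋_ ; _+_ = _:+_ ; _*_ = _:*_ ; -_ = :-_
  ; 0# = con 0ℚ ; 1# = con 1ℚ
  ; isCommutativeRing = record
    { isRing = record
      { +-isAbelianGroup = record
        { isGroup = record
          { isMonoid = record
            { isSemigroup = record
              { isMagma = record
                { isEquivalence = record { refl = ≋-refl ; sym = ≋-sym ; trans = ≋-trans }
                ; ∙-cong = +-cong }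
              ; assoc = +-assoc }
            ; identity = +-identity , λ p → ≋-trans (+-comm p _) (+-identity p) }
          ; inverse = +-inverse , λ p → ≋-trans (+-comm p _) (+-inverse p)
          ; ⁻¹-cong = neg-cong }
        ; comm = +-comm }
      ; *-cong = *-cong
      ; *-assoc = *-assoc
      ; *-identity = *-identity , λ p → ≋-trans (*-comm p _) (*-identity p)
      ; distrib = (λ p q r → ≋-trans (*-comm p _)
                     (≋-trans (distrib p q r) (+-cong (*-comm q p) (*-comm r p))))
                , distrib }
    ; *-comm = *-comm }
  }


-- Proved over an arbitrary semiring because the solver is slow when it is run
-- directly on Poly.
module Identities {c ℓ} (R : CommutativeSemiring c ℓ) where
  open CommutativeSemiring R
  open import Algebra.Solver.Ring.NaturalCoefficients.Default R
    using (solve; _:=_) renaming (_:+_ to _⊕_; _:*_ to _⊗_)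

  split-+ : ∀ a b c d x → (a + x * b) + (c + x * d) ≈ (a + c) + x * (b + d)
  split-+ = solve 5 (λ a b c d x → (a ⊕ x ⊗ b) ⊕ (c ⊕ x ⊗ d) := (a ⊕ c) ⊕ x ⊗ (b ⊕ d)) refl

  split-*₁ : ∀ a b q x → (a + x * b) * q ≈ a * q + x * (b * q)
  split-*₁ = solve 4 (λ a b q x → (a ⊕ x ⊗ b) ⊗ q := a ⊗ q ⊕ x ⊗ (b ⊗ q)) refl

  split-*₂ : ∀ a c d e x → a * (c + x * d) + x * e ≈ a * c + x * (e + a * d)
  split-*₂ = solve 5 (λ a c d e x → a ⊗ (c ⊕ x ⊗ d) ⊕ x ⊗ e := a ⊗ c ⊕ x ⊗ (e ⊕ a ⊗ d)) refl

  ψ-assoc : ∀ p′ q r p q₀ q′ r′ → (p′ * q + p * q′) * r + (p * q₀) * r′ ≈ p′ * (q * r) + p * (q′ * r + q₀ * r′)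
  ψ-assoc = solve 7 (λ p′ q r p q₀ q′ r′ → (p′ ⊗ q ⊕ p ⊗ q′) ⊗ r ⊕ (p ⊗ q₀) ⊗ r′ := p′ ⊗ (q ⊗ r) ⊕ p ⊗ (q′ ⊗ r ⊕ q₀ ⊗ r′)) refl

  ψ-comm : ∀ p′ q₀ x q′ p₀ → p′ * (q₀ + x * q′) + p₀ * q′ ≈ q′ * (p₀ + x * p′) + q₀ * p′
  ψ-comm = solve 5 (λ p′ q₀ x q′ p₀ → p′ ⊗ (q₀ ⊕ x ⊗ q′) ⊕ p₀ ⊗ q′ := q′ ⊗ (p₀ ⊕ x ⊗ p′) ⊕ q₀ ⊗ p′) refl

  ψ-distrib : ∀ q′ r′ p q₀ r₀ p′ → (q′ + r′) * p + (q₀ + r₀) * p′ ≈ (q′ * p + q₀ * p′) + (r′ * p + r₀ * p′)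
  ψ-distrib = solve 6 (λ q′ r′ p q₀ r₀ p′ → (q′ ⊕ r′) ⊗ p ⊕ (q₀ ⊕ r₀) ⊗ p′ := (q′ ⊗ p ⊕ q₀ ⊗ p′) ⊕ (r′ ⊗ p ⊕ r₀ ⊗ p′)) refl

  ᶠ-trans₁ : ∀ b a c → b * (a * c) ≈ (a * b) * c
  ᶠ-trans₁ = solve 3 (λ b a c → b ⊗ (a ⊗ c) := (a ⊗ b) ⊗ c) refl

  ᶠ-trans₂ : ∀ a b c → (a * b) * c ≈ (a * c) * b
  ᶠ-trans₂ = solve 3 (λ a b c → (a ⊗ b) ⊗ c := (a ⊗ c) ⊗ b) refl

  ᶠ-trans₃ : ∀ a b c → (a * b) * c ≈ b * (a * c)
  ᶠ-trans₃ = solve 3 (λ a b c → (a ⊗ b) ⊗ c := b ⊗ (a ⊗ c)) refl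

  ᶠ-+-cong₁ : ∀ a b c d b′ d′ → (a * d + c * b) * (b′ * d′) ≈ (a * b′) * (d * d′) + (c * d′) * (b * b′)
  ᶠ-+-cong₁ = solve 6 (λ a b c d b′ d′ → (a ⊗ d ⊕ c ⊗ b) ⊗ (b′ ⊗ d′) := (a ⊗ b′) ⊗ (d ⊗ d′) ⊕ (c ⊗ d′) ⊗ (b ⊗ b′)) refl

  ᶠ-+-cong₂ : ∀ a b c d b′ d′ → (a * b′) * (d′ * d) + (c * d′) * (b′ * b) ≈ (a * d + c * b) * (b′ * d′)
  ᶠ-+-cong₂ = solve 6 (λ a b c d b′ d′ → (a ⊗ b′) ⊗ (d′ ⊗ d) ⊕ (c ⊗ d′) ⊗ (b′ ⊗ b) := (a ⊗ d ⊕ c ⊗ b) ⊗ (b′ ⊗ d′)) refl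

  ᶠ-interchange : ∀ a b c d → a * b * (c * d) ≈ a * c * (b * d)
  ᶠ-interchange = solve 4 (λ a b c d → a ⊗ b ⊗ (c ⊗ d) := a ⊗ c ⊗ (b ⊗ d)) refl

  ᶠ-+-assoc : ∀ a b c d e f → (a * d + c * b) * f + e * (b * d) ≈ a * (d * f) + (c * f + e * d) * b
  ᶠ-+-assoc = solve 6 (λ a b c d e f → (a ⊗ d ⊕ c ⊗ b) ⊗ f ⊕ e ⊗ (b ⊗ d) := a ⊗ (d ⊗ f) ⊕ (c ⊗ f ⊕ e ⊗ d) ⊗ b) refl

  ᶠ-distribˡ : ∀ a b c d e f → (a * (c * f + e * d)) * ((b * d) * (b * f)) ≈ ((a * c) * (b * f) + (a * e) * (b * d)) * (b * (d * f))
  ᶠ-distribˡ = solve 6 (λ a b c d e f → (a ⊗ (c ⊗ f ⊕ e ⊗ d)) ⊗ ((b ⊗ d) ⊗ (b ⊗ f)) := ((a ⊗ c) ⊗ (b ⊗ f) ⊕ (a ⊗ e) ⊗ (b ⊗ d)) ⊗ (b ⊗ (d ⊗ f))) refl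

  ᶠ-distribʳ : ∀ a b c d e f → ((c * f + e * d) * a) * ((d * b) * (f * b)) ≈ ((c * a) * (f * b) + (e * a) * (d * b)) * ((d * f) * b)
  ᶠ-distribʳ = solve 6 (λ a b c d e f → ((c ⊗ f ⊕ e ⊗ d) ⊗ a) ⊗ ((d ⊗ b) ⊗ (f ⊗ b)) := ((c ⊗ a) ⊗ (f ⊗ b) ⊕ (e ⊗ a) ⊗ (d ⊗ b)) ⊗ ((d ⊗ f) ⊗ b)) refl

  ᶠ-inverse : ∀ a b o → a * b * o ≈ o * (b * a)
  ᶠ-inverse = solve 3 (λ a b o → a ⊗ b ⊗ o := o ⊗ (b ⊗ a)) refl

private
  module P where
    open CommutativeRing ℚ[x] public
    open import Algebra.Properties.Ring ring public

  module Id = Identities P.commutativeSemiring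

  module PR = Relation.Binary.Reasoning.Setoid P.setoid
  open PR using (begin_; step-≈-⟩; step-≈-⟨; _∎)

neg-0 : :- con 0ℚ ≋ con 0ℚ
neg-0 = P.-0#≈0#

⟦_⟧ : Poly → (ℕ → ℚ) → ℚ
⟦ con a ⟧  ρ = a
⟦ var i ⟧  ρ = ρ i
⟦ p :+ q ⟧ ρ = ⟦ p ⟧ ρ ℚ.+ ⟦ q ⟧ ρ
⟦ p :* q ⟧ ρ = ⟦ p ⟧ ρ ℚ.* ⟦ q ⟧ ρ
⟦ :- p ⟧   ρ = ℚ.- ⟦ p ⟧ ρ

⟦⟧-cong : ∀ {p q} → p ≋ q → ∀ ρ → ⟦ p ⟧ ρ ≡ ⟦ q ⟧ ρ
⟦⟧-cong ≋-refl            ρ = ≡.refl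
⟦⟧-cong (≋-sym e)         ρ = ≡.sym (⟦⟧-cong e ρ)
⟦⟧-cong (≋-trans e f)     ρ = ≡.trans (⟦⟧-cong e ρ) (⟦⟧-cong f ρ)
⟦⟧-cong (+-cong e f)      ρ = ≡.cong₂ ℚ._+_ (⟦⟧-cong e ρ) (⟦⟧-cong f ρ)
⟦⟧-cong (*-cong e f)      ρ = ≡.cong₂ ℚ._*_ (⟦⟧-cong e ρ) (⟦⟧-cong f ρ)
⟦⟧-cong (neg-cong e)      ρ = ≡.cong ℚ.-_ (⟦⟧-cong e ρ)
⟦⟧-cong (+-assoc p q r)   ρ = ℚ.+-assoc (⟦ p ⟧ ρ) (⟦ q ⟧ ρ) (⟦ r ⟧ ρ)
⟦⟧-cong (+-comm p q)      ρ = ℚ.+-comm (⟦ p ⟧ ρ) (⟦ q ⟧ ρ)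
⟦⟧-cong (+-identity p)    ρ = ℚ.+-identityˡ (⟦ p ⟧ ρ)
⟦⟧-cong (+-inverse p)     ρ = ℚ.+-inverseˡ (⟦ p ⟧ ρ)
⟦⟧-cong (*-assoc p q r)   ρ = ℚ.*-assoc (⟦ p ⟧ ρ) (⟦ q ⟧ ρ) (⟦ r ⟧ ρ)
⟦⟧-cong (*-comm p q)      ρ = ℚ.*-comm (⟦ p ⟧ ρ) (⟦ q ⟧ ρ)
⟦⟧-cong (*-identity p)    ρ = ℚ.*-identityˡ (⟦ p ⟧ ρ)
⟦⟧-cong (distrib p q r)   ρ = ℚ.*-distribʳ-+ (⟦ p ⟧ ρ) (⟦ q ⟧ ρ) (⟦ r ⟧ ρ)
⟦⟧-cong (con-+ a b)       ρ = ≡.refl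
⟦⟧-cong (con-* a b)       ρ = ≡.refl

ℚ-integral : ∀ a b → a ℚ.* b ≡ 0ℚ → a ≡ 0ℚ ⊎ b ≡ 0ℚ
ℚ-integral a b ab≡0 with a ℚ.≟ 0ℚ
... | yes a≡0 = inj₁ a≡0
... | no  a≢0 = inj₂ (begin′
  b                     ≡⟨ ℚ.*-identityˡ b ⟨
  1ℚ ℚ.* b              ≡⟨ ≡.cong (ℚ._* b) (ℚ.*-inverseˡ a) ⟨
  (ℚ.1/ a) ℚ.* a ℚ.* b  ≡⟨ ℚ.*-assoc (ℚ.1/ a) a b ⟩
  (ℚ.1/ a) ℚ.* (a ℚ.* b) ≡⟨ ≡.cong ((ℚ.1/ a) ℚ.*_) ab≡0 ⟩
  (ℚ.1/ a) ℚ.* 0ℚ       ≡⟨ ℚ.*-zeroʳ (ℚ.1/ a) ⟩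
  0ℚ                    ∎′)
  where
  open ≡.≡-Reasoning using (step-≡-⟩; step-≡-⟨) renaming (begin_ to begin′_; _∎ to _∎′)
  instance
    a-nonZero : ℚ.NonZero a
    a-nonZero = ℚ.≢-nonZero a≢0

1≉0 : con 1ℚ ≉ con 0ℚ
1≉0 e with () ← ⟦⟧-cong e (λ _ → 0ℚ)

-- ℚ[x₀, x₁, …] is an integral domain.  For a fixed variable x = var k,
-- write p = σ p + x ψ p, where σ substitutes 0 for x.  Then ψ (x p) = p, so x
-- can be cancelled, and iterating ψ on p eventually gives 0.

module Split (k : ℕ) where

  σ : Poly → Poly
  σ (con a)  = con a
  σ (var i) with i ≟ k
  ... | yes _ = con 0ℚ
  ... | no  _ = var i
  σ (p :+ q) = σ p :+ σ q
  σ (p :* q) = σ p :* σ q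
  σ (:- p)   = :- σ p

  ψ : Poly → Poly
  ψ (con a)  = con 0ℚ
  ψ (var i) with i ≟ k
  ... | yes _ = con 1ℚ
  ... | no  _ = con 0ℚ
  ψ (p :+ q) = ψ p :+ ψ q
  ψ (p :* q) = ψ p :* q :+ σ p :* ψ q
  ψ (:- p)   = :- ψ p

  split : ∀ p → p ≋ σ p :+ var k :* ψ p
  split (con a) = P.sym (P.trans (P.+-congˡ (P.zeroʳ _)) (P.+-identityʳ _))
  split (var i) with i ≟ k
  ... | yes ≡.refl = P.sym (P.trans (P.+-identityˡ _) (P.*-identityʳ _))
  ... | no  _      = P.sym (P.trans (P.+-congˡ (P.zeroʳ _)) (P.+-identityʳ _))
  split (p :+ q) = P.trans (+-cong (split p) (split q))
    (Id.split-+ (σ p) (ψ p) (σ q) (ψ q) (var k))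
  split (p :* q) = begin
    p :* q                                        ≈⟨ P.*-congʳ (split p) ⟩
    (σ p :+ x :* ψ p) :* q                        ≈⟨ Id.split-*₁ (σ p) (ψ p) q x ⟩
    σ p :* q :+ x :* (ψ p :* q)                   ≈⟨ P.+-congʳ (P.*-congˡ (split q)) ⟩
    σ p :* (σ q :+ x :* ψ q) :+ x :* (ψ p :* q)   ≈⟨ Id.split-*₂ (σ p) (σ q) (ψ q) (ψ p :* q) x ⟩
    σ p :* σ q :+ x :* (ψ p :* q :+ σ p :* ψ q)   ∎
    where x = var k
  split (:- p) = begin
    :- p                       ≈⟨ neg-cong (split p) ⟩
    :- (σ p :+ var k :* ψ p)   ≈⟨ P.-‿+-comm (σ p) _ ⟨
    :- σ p :+ :- (var k :* ψ p) ≈⟨ P.+-congˡ (P.-‿distribʳ-* (var k) (ψ p)) ⟩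
    :- σ p :+ var k :* (:- ψ p) ∎

  σ-cong : ∀ {p q} → p ≋ q → σ p ≋ σ q
  σ-cong ≋-refl          = ≋-refl
  σ-cong (≋-sym e)       = ≋-sym (σ-cong e)
  σ-cong (≋-trans e f)   = ≋-trans (σ-cong e) (σ-cong f)
  σ-cong (+-cong e f)    = +-cong (σ-cong e) (σ-cong f)
  σ-cong (*-cong e f)    = *-cong (σ-cong e) (σ-cong f)
  σ-cong (neg-cong e)    = neg-cong (σ-cong e)
  σ-cong (+-assoc p q r) = +-assoc (σ p) (σ q) (σ r)
  σ-cong (+-comm p q)    = +-comm (σ p) (σ q)
  σ-cong (+-identity p)  = +-identity (σ p)
  σ-cong (+-inverse p)   = +-inverse (σ p)
  σ-cong (*-assoc p q r) = *-assoc (σ p) (σ q) (σ r)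
  σ-cong (*-comm p q)    = *-comm (σ p) (σ q)
  σ-cong (*-identity p)  = *-identity (σ p)
  σ-cong (distrib p q r) = distrib (σ p) (σ q) (σ r)
  σ-cong (con-+ a b)     = con-+ a b
  σ-cong (con-* a b)     = con-* a b

  ψ-cong : ∀ {p q} → p ≋ q → ψ p ≋ ψ q
  ψ-cong ≋-refl          = ≋-refl
  ψ-cong (≋-sym e)       = ≋-sym (ψ-cong e)
  ψ-cong (≋-trans e f)   = ≋-trans (ψ-cong e) (ψ-cong f)
  ψ-cong (+-cong e f)    = +-cong (ψ-cong e) (ψ-cong f)
  ψ-cong (*-cong e f)    = +-cong (*-cong (ψ-cong e) f) (*-cong (σ-cong e) (ψ-cong f))
  ψ-cong (neg-cong e)    = neg-cong (ψ-cong e)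
  ψ-cong (+-assoc p q r) = +-assoc (ψ p) (ψ q) (ψ r)
  ψ-cong (+-comm p q)    = +-comm (ψ p) (ψ q)
  ψ-cong (+-identity p)  = +-identity (ψ p)
  ψ-cong (+-inverse p)   = +-inverse (ψ p)
  ψ-cong (*-assoc p q r) =
    Id.ψ-assoc (ψ p) q r (σ p) (σ q) (ψ q) (ψ r)
  ψ-cong (*-comm p q)    = begin
    ψ p :* q :+ σ p :* ψ q                      ≈⟨ P.+-congʳ (P.*-congˡ (split q)) ⟩
    ψ p :* (σ q :+ var k :* ψ q) :+ σ p :* ψ q  ≈⟨ Id.ψ-comm (ψ p) (σ q) (var k) (ψ q) (σ p) ⟩
    ψ q :* (σ p :+ var k :* ψ p) :+ σ q :* ψ p  ≈⟨ P.+-congʳ (P.*-congˡ (split p)) ⟨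
    ψ q :* p :+ σ q :* ψ p                      ∎
  ψ-cong (*-identity p)  =
    P.trans (+-cong (P.zeroˡ p) (P.*-identityˡ (ψ p))) (P.+-identityˡ _)
  ψ-cong (distrib p q r) =
    Id.ψ-distrib (ψ q) (ψ r) p (σ q) (σ r) (ψ p)
  ψ-cong (con-+ a b)     = P.sym (P.+-identityˡ _)
  ψ-cong (con-* a b)     = P.sym (P.trans (+-cong (P.zeroˡ _) (P.zeroʳ _)) (P.+-identityˡ _))

  σ-x : σ (var k) ≋ con 0ℚ
  σ-x with k ≟ k
  ... | yes _   = ≋-refl
  ... | no  k≢k = ⊥-elim (k≢k ≡.refl)

  ψ-x : ψ (var k) ≋ con 1ℚ
  ψ-x with k ≟ k
  ... | yes _   = ≋-refl
  ... | no  k≢k = ⊥-elim (k≢k ≡.refl)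

  cancel-x : ∀ p → var k :* p ≋ con 0ℚ → p ≋ con 0ℚ
  cancel-x p e = begin
    p                                       ≈⟨ P.*-identityˡ p ⟨
    con 1ℚ :* p                             ≈⟨ P.+-identityʳ _ ⟨
    con 1ℚ :* p :+ con 0ℚ                   ≈⟨ +-cong (P.*-congʳ ψ-x) (P.trans (P.*-congʳ σ-x) (P.zeroˡ _)) ⟨
    ψ (var k) :* p :+ σ (var k) :* ψ p      ≈⟨ ψ-cong e ⟩
    con 0ℚ                                  ∎

  σ-idem : ∀ p → σ (σ p) ≋ σ p
  σ-idem (con a)  = ≋-refl
  σ-idem (var i) with i ≟ k
  ... | yes _ = ≋-refl
  ... | no i≢k with i ≟ k
  ...   | yes i≡k = ⊥-elim (i≢k i≡k)
  ...   | no  _   = ≋-refl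
  σ-idem (p :+ q) = +-cong (σ-idem p) (σ-idem q)
  σ-idem (p :* q) = *-cong (σ-idem p) (σ-idem q)
  σ-idem (:- p)   = neg-cong (σ-idem p)

  ψσ : ∀ p → ψ (σ p) ≋ con 0ℚ
  ψσ (con a)  = ≋-refl
  ψσ (var i) with i ≟ k
  ... | yes _ = ≋-refl
  ... | no i≢k with i ≟ k
  ...   | yes i≡k = ⊥-elim (i≢k i≡k)
  ...   | no  _   = ≋-refl
  ψσ (p :+ q) = P.trans (+-cong (ψσ p) (ψσ q)) (P.+-identityˡ _)
  ψσ (p :* q) = P.trans
    (+-cong (P.trans (P.*-congʳ (ψσ p)) (P.zeroˡ _)) (P.trans (P.*-congˡ (ψσ q)) (P.zeroʳ _)))
    (P.+-identityˡ _)
  ψσ (:- p)   = P.trans (neg-cong (ψσ p)) neg-0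

  -- p has degree less than n in x.
  Deg< : ℕ → Poly → Set
  Deg< zero    p = p ≋ con 0ℚ
  Deg< (suc n) p = Deg< n (ψ p)

  Deg<-resp : ∀ n {p q} → p ≋ q → Deg< n p → Deg< n q
  Deg<-resp zero    e d = P.trans (P.sym e) d
  Deg<-resp (suc n) e d = Deg<-resp n (ψ-cong e) d

  Deg<-0 : ∀ n → Deg< n (con 0ℚ)
  Deg<-0 zero    = ≋-refl
  Deg<-0 (suc n) = Deg<-0 n

  Deg<-mono : ∀ {m n p} → m ≤ n → Deg< m p → Deg< n p
  Deg<-mono {n = n} z≤n d = Deg<-resp n (P.sym d) (Deg<-0 n)
  Deg<-mono (s≤s m≤n) d = Deg<-mono m≤n d

  Deg<-+ : ∀ n {p q} → Deg< n p → Deg< n q → Deg< n (p :+ q)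
  Deg<-+ zero    d e = P.trans (+-cong d e) (P.+-identityˡ _)
  Deg<-+ (suc n) d e = Deg<-+ n d e

  Deg<-neg : ∀ n {p} → Deg< n p → Deg< n (:- p)
  Deg<-neg zero    d = P.trans (neg-cong d) neg-0
  Deg<-neg (suc n) d = Deg<-neg n d

  Deg<-σ* : ∀ n p {q} → Deg< n q → Deg< n (σ p :* q)
  Deg<-σ* zero    p d = P.trans (P.*-congˡ d) (P.zeroʳ _)
  Deg<-σ* (suc n) p {q} d = Deg<-resp n (P.sym (begin
    ψ (σ p) :* q :+ σ (σ p) :* ψ q  ≈⟨ +-cong (P.trans (P.*-congʳ (ψσ p)) (P.zeroˡ q)) (P.*-congʳ (σ-idem p)) ⟩
    con 0ℚ :+ σ p :* ψ q            ≈⟨ P.+-identityˡ _ ⟩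
    σ p :* ψ q                      ∎)) (Deg<-σ* n p d)

  Deg<-* : ∀ m n {p q} → Deg< m p → Deg< n q → Deg< (m ℕ.+ n) (p :* q)
  Deg<-* zero    n d e = Deg<-resp n (P.sym (P.trans (P.*-congʳ d) (P.zeroˡ _))) (Deg<-0 n)
  Deg<-* (suc m) n {p} {q} d e = Deg<-+ (m ℕ.+ n) (Deg<-* m n d e)
    (Deg<-mono (ℕ.≤-trans (ℕ.pred[n]≤n {n}) (ℕ.m≤n+m n m)) (Deg<-σ* (n ∸ 1) p (Deg<-ψ n q e)))
    where
    Deg<-ψ : ∀ n q → Deg< n q → Deg< (n ∸ 1) (ψ q)
    Deg<-ψ zero    q e = ψ-cong e
    Deg<-ψ (suc n) q e = e

  degree : ∀ p → ∃ λ n → Deg< n p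
  degree (con a)  = 1 , ≋-refl
  degree (var i)  = 2 , ψψ
    where
    ψψ : ψ (ψ (var i)) ≋ con 0ℚ
    ψψ with i ≟ k
    ... | yes _ = ≋-refl
    ... | no  _ = ≋-refl
  degree (p :+ q) with degree p | degree q
  ... | m , d | n , e =
    m ⊔ n , Deg<-+ (m ⊔ n) (Deg<-mono (ℕ.m≤m⊔n m n) d) (Deg<-mono (ℕ.m≤n⊔m m n) e)
  degree (p :* q) with degree p | degree q
  ... | m , d | n , e = m ℕ.+ n , Deg<-* m n d e
  degree (:- p) with degree p
  ... | m , d = m , Deg<-neg m d

-- p only involves the variables var 0, …, var (k − 1).
data Below (k : ℕ) : Poly → Set where
  con  : ∀ a → Below k (con a)
  var  : ∀ {i} → i < k → Below k (var i)
  _:+_ : ∀ {p q} → Below k p → Below k q → Below k (p :+ q)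
  _:*_ : ∀ {p q} → Below k p → Below k q → Below k (p :* q)
  :-_  : ∀ {p} → Below k p → Below k (:- p)

Below-mono : ∀ {k l p} → k ≤ l → Below k p → Below l p
Below-mono le (con a)  = con a
Below-mono le (var lt) = var (ℕ.≤-trans lt le)
Below-mono le (b :+ c) = Below-mono le b :+ Below-mono le c
Below-mono le (b :* c) = Below-mono le b :* Below-mono le c
Below-mono le (:- b)   = :- Below-mono le b

below : ∀ p → ∃ λ k → Below k p
below (con a)  = 0 , con a
below (var i)  = suc i , var ℕ.≤-refl
below (p :+ q) with below p | below q
... | k , b | l , c = k ⊔ l , Below-mono (ℕ.m≤m⊔n k l) b :+ Below-mono (ℕ.m≤n⊔m k l) c
below (p :* q) with below p | below q
... | k , b | l , c = k ⊔ l , Below-mono (ℕ.m≤m⊔n k l) b :* Below-mono (ℕ.m≤n⊔m k l) c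
below (:- p) with below p
... | k , b = k , :- b

module _ {k : ℕ} where
  open Split k

  Below-σ : ∀ {p} → Below (suc k) p → Below k (σ p)
  Below-σ (con a)  = con a
  Below-σ (var {i} lt) with i ≟ k
  ... | yes _   = con 0ℚ
  ... | no  i≢k = var (ℕ.≤∧≢⇒< (ℕ.≤-pred lt) i≢k)
  Below-σ (b :+ c) = Below-σ b :+ Below-σ c
  Below-σ (b :* c) = Below-σ b :* Below-σ c
  Below-σ (:- b)   = :- Below-σ b

  Below-ψ : ∀ {p} → Below (suc k) p → Below (suc k) (ψ p)
  Below-ψ (con a)  = con 0ℚ
  Below-ψ (var {i} lt) with i ≟ k
  ... | yes _ = con 1ℚ
  ... | no  _ = con 0ℚ
  Below-ψ (b :+ c) = Below-ψ b :+ Below-ψ c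
  Below-ψ (b :* c) = Below-ψ b :* c :+ Below-mono (ℕ.n≤1+n k) (Below-σ b) :* Below-ψ c
  Below-ψ (:- b)   = :- Below-ψ b

con-neg : ∀ a → con (ℚ.- a) ≋ :- con a
con-neg a = P.+-inverseˡ-unique (con (ℚ.- a)) (con a)
  (P.trans (P.sym (con-+ (ℚ.- a) a)) (P.reflexive (≡.cong con (ℚ.+-inverseˡ a))))

constant : ∀ {p} → Below 0 p → ∃ λ a → p ≋ con a
constant (con a) = a , ≋-refl
constant (b :+ c) with constant b | constant c
... | x , e | y , f = x ℚ.+ y , P.trans (+-cong e f) (P.sym (con-+ x y))
constant (b :* c) with constant b | constant c
... | x , e | y , f = x ℚ.* y , P.trans (*-cong e f) (P.sym (con-* x y))
constant (:- b) with constant b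
... | x , e = ℚ.- x , P.trans (neg-cong e) (P.sym (con-neg x))

IntegralBelow : ℕ → Set
IntegralBelow k = ∀ {p q} → Below k p → Below k q → p :* q ≋ con 0ℚ → p ≋ con 0ℚ ⊎ q ≋ con 0ℚ

module _ {k : ℕ} (ih : IntegralBelow k) where
  open Split k

  private
    p≋xψp : ∀ p → σ p ≋ con 0ℚ → p ≋ var k :* ψ p
    p≋xψp p e = P.trans (split p) (P.trans (P.+-congʳ e) (P.+-identityˡ _))

    ψp≋0⇒p≋0 : ∀ p → σ p ≋ con 0ℚ → ψ p ≋ con 0ℚ → p ≋ con 0ℚ
    ψp≋0⇒p≋0 p e f = P.trans (p≋xψp p e) (P.trans (P.*-congˡ f) (P.zeroʳ _))

    ψp*q≋0 : ∀ p q → σ p ≋ con 0ℚ → p :* q ≋ con 0ℚ → ψ p :* q ≋ con 0ℚ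
    ψp*q≋0 p q e f = cancel-x (ψ p :* q)
      (P.trans (P.sym (P.trans (P.*-congʳ (p≋xψp p e)) (*-assoc _ _ _))) f)

  integral-step : ∀ m n {p q} → Deg< m p → Deg< n q → Below (suc k) p → Below (suc k) q →
                  p :* q ≋ con 0ℚ → p ≋ con 0ℚ ⊎ q ≋ con 0ℚ
  integral-step zero    n       d e b c f = inj₁ d
  integral-step (suc m) zero    d e b c f = inj₂ e
  integral-step (suc m) (suc n) {p} {q} d e b c f = [ σp-zero , σq-zero ]′
    (ih (Below-σ b) (Below-σ c) (σ-cong f))
    where
    σp-zero : σ p ≋ con 0ℚ → p ≋ con 0ℚ ⊎ q ≋ con 0ℚ
    σp-zero z = map₁ (ψp≋0⇒p≋0 p z)
      (integral-step m (suc n) d e (Below-ψ b) c (ψp*q≋0 p q z f))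

    σq-zero : σ q ≋ con 0ℚ → p ≋ con 0ℚ ⊎ q ≋ con 0ℚ
    σq-zero z = map₂ (ψp≋0⇒p≋0 q z)
      (integral-step (suc m) n d e b (Below-ψ c)
        (P.trans (*-comm p (ψ q)) (ψp*q≋0 q p z (P.trans (*-comm q p) f))))

integral-below : ∀ k → IntegralBelow k
integral-below zero b c f with constant b | constant c
... | x , e | y , e′
  with ℚ-integral x y (⟦⟧-cong (P.trans (P.sym (*-cong e e′)) f) (λ _ → 0ℚ))
...   | inj₁ x≡0 = inj₁ (P.trans e (P.reflexive (≡.cong con x≡0)))
...   | inj₂ y≡0 = inj₂ (P.trans e′ (P.reflexive (≡.cong con y≡0)))
integral-below (suc k) {p} {q} b c f =
  integral-step (integral-below k) (proj₁ (degree p)) (proj₁ (degree q))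
    (proj₂ (degree p)) (proj₂ (degree q)) b c f
  where open Split k

integral : ∀ p q → p :* q ≋ con 0ℚ → p ≋ con 0ℚ ⊎ q ≋ con 0ℚ
integral p q with below p | below q
... | k , b | l , c =
  integral-below (k ⊔ l) (Below-mono (ℕ.m≤m⊔n k l) b) (Below-mono (ℕ.m≤n⊔m k l) c)

*-cancelˡ : ∀ {p q r} → p ≉ con 0ℚ → p :* q ≋ p :* r → q ≋ r
*-cancelˡ {p} {q} {r} p≉0 e with integral p (q :+ :- r) (begin
    p :* (q :+ :- r)        ≈⟨ P.distribˡ p q (:- r) ⟩
    p :* q :+ p :* :- r     ≈⟨ +-cong e (P.sym (P.-‿distribʳ-* p r)) ⟩
    p :* r :+ :- (p :* r)   ≈⟨ P.-‿inverseʳ _ ⟩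
    con 0ℚ                  ∎)
... | inj₁ p≋0   = ⊥-elim (p≉0 p≋0)
... | inj₂ q-r≋0 = P.trans (P.+-inverseˡ-unique q (:- r) q-r≋0) (P.-‿involutive r)

*-≉0 : ∀ {p q} → p ≉ con 0ℚ → q ≉ con 0ℚ → p :* q ≉ con 0ℚ
*-≉0 {p} {q} p≉0 q≉0 pq≋0 with integral p q pq≋0
... | inj₁ p≋0 = p≉0 p≋0
... | inj₂ q≋0 = q≉0 q≋0

record Fraction : Set where
  field
    num   : Poly
    den   : Poly
    den≉0 : den ≉ con 0ℚ

open Fraction

infix 4 _≃_

_≃_ : Fraction → Fraction → Set
x ≃ y = num x :* den y ≋ num y :* den x

[_/_] : (p q : Poly) {q≉0 : q ≉ con 0ℚ} → Fraction
[ p / q ] {q≉0} = record { num = p ; den = q ; den≉0 = q≉0 }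

ι : Poly → Fraction
ι p = [ p / con 1ℚ ] {1≉0}

infixl 6 _+ᶠ_
infixl 7 _*ᶠ_
infix  8 -ᶠ_

_+ᶠ_ _*ᶠ_ : Fraction → Fraction → Fraction
x +ᶠ y = [ num x :* den y :+ num y :* den x / den x :* den y ] {*-≉0 (den≉0 x) (den≉0 y)}
x *ᶠ y = [ num x :* num y / den x :* den y ] {*-≉0 (den≉0 x) (den≉0 y)}

-ᶠ_ : Fraction → Fraction
-ᶠ x = [ :- num x / den x ] {den≉0 x}

≃-trans : ∀ x y z → x ≃ y → y ≃ z → x ≃ z
≃-trans x y z e f = *-cancelˡ (den≉0 y) (begin
  den y :* (num x :* den z)   ≈⟨ Id.ᶠ-trans₁ (den y) (num x) (den z) ⟩
  num x :* den y :* den z     ≈⟨ P.*-congʳ e ⟩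
  num y :* den x :* den z     ≈⟨ Id.ᶠ-trans₂ (num y) (den x) (den z) ⟩
  num y :* den z :* den x     ≈⟨ P.*-congʳ f ⟩
  num z :* den y :* den x     ≈⟨ Id.ᶠ-trans₃ (num z) (den y) (den x) ⟩
  den y :* (num z :* den x)   ∎)

+ᶠ-cong : ∀ x x′ y y′ → x ≃ x′ → y ≃ y′ → (x +ᶠ y) ≃ (x′ +ᶠ y′)
+ᶠ-cong x x′ y y′ e f = begin
  (num x :* den y :+ num y :* den x) :* (den x′ :* den y′)
    ≈⟨ Id.ᶠ-+-cong₁ (num x) (den x) (num y) (den y) (den x′) (den y′) ⟩
  (num x :* den x′) :* (den y :* den y′) :+ (num y :* den y′) :* (den x :* den x′)
    ≈⟨ +-cong (P.*-congʳ e) (P.*-congʳ f) ⟩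
  (num x′ :* den x) :* (den y :* den y′) :+ (num y′ :* den y) :* (den x :* den x′)
    ≈⟨ Id.ᶠ-+-cong₂ (num x′) (den x′) (num y′) (den y′) (den x) (den y) ⟩
  (num x′ :* den y′ :+ num y′ :* den x′) :* (den x :* den y) ∎

*ᶠ-cong : ∀ x x′ y y′ → x ≃ x′ → y ≃ y′ → (x *ᶠ y) ≃ (x′ *ᶠ y′)
*ᶠ-cong x x′ y y′ e f = begin
  num x :* num y :* (den x′ :* den y′)     ≈⟨ Id.ᶠ-interchange (num x) (num y) (den x′) (den y′) ⟩
  num x :* den x′ :* (num y :* den y′)     ≈⟨ *-cong e f ⟩
  num x′ :* den x :* (num y′ :* den y)     ≈⟨ Id.ᶠ-interchange (num x′) (den x) (num y′) (den y) ⟩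
  num x′ :* num y′ :* (den x :* den y)     ∎

-ᶠ-cong : ∀ x x′ → x ≃ x′ → (-ᶠ x) ≃ (-ᶠ x′)
-ᶠ-cong x x′ e =
  P.trans (P.sym (P.-‿distribˡ-* _ _)) (P.trans (neg-cong e) (P.-‿distribˡ-* _ _))

ℚ⟨x⟩ : CommutativeRing 0ℓ 0ℓ
ℚ⟨x⟩ = record
  { Carrier = Fraction ; _≈_ = _≃_ ; _+_ = _+ᶠ_ ; _*_ = _*ᶠ_ ; -_ = -ᶠ_
  ; 0# = ι (con 0ℚ) ; 1# = ι (con 1ℚ)
  ; isCommutativeRing = record
    { isRing = record
      { +-isAbelianGroup = record
        { isGroup = record
          { isMonoid = record
            { isSemigroup = record
              { isMagma = record
                { isEquivalence = record
                  { refl = ≋-refl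
                  ; sym = ≋-sym
                  ; trans = λ {x} {y} {z} → ≃-trans x y z }
                ; ∙-cong = λ {x} {x′} {y} {y′} → +ᶠ-cong x x′ y y′ }
              ; assoc = λ x y z → equal (Id.ᶠ-+-assoc (num x) (den x) (num y) (den y) (num z) (den z)) (*-assoc _ _ _) }
            ; identity = (λ x → equal (+0ˡ x) (*-identity _))
                       , (λ x → equal (P.trans (+-comm _ _) (+0ˡ x)) (P.*-identityʳ _)) }
          ; inverse = (λ x → zero-num (-x+x x))
                    , (λ x → zero-num (P.trans (+-comm _ _) (-x+x x)))
          ; ⁻¹-cong = λ {x} {x′} → -ᶠ-cong x x′ }
        ; comm = λ x y → equal (+-comm _ _) (*-comm _ _) }
      ; *-cong = λ {x} {x′} {y} {y′} → *ᶠ-cong x x′ y y′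
      ; *-assoc = λ x y z → equal (*-assoc _ _ _) (*-assoc _ _ _)
      ; *-identity = (λ x → equal (*-identity _) (*-identity _))
                   , (λ x → equal (P.*-identityʳ _) (P.*-identityʳ _))
      ; distrib = (λ x y z → Id.ᶠ-distribˡ (num x) (den x) (num y) (den y) (num z) (den z))
                , (λ x y z → Id.ᶠ-distribʳ (num x) (den x) (num y) (den y) (num z) (den z)) }
    ; *-comm = λ x y → equal (*-comm _ _) (*-comm _ _) }
  }
  where
  equal : ∀ {p p′ q q′} → p ≋ p′ → q ≋ q′ → p :* q′ ≋ p′ :* q
  equal e f = *-cong e (P.sym f)

  +0ˡ : ∀ x → con 0ℚ :* den x :+ num x :* con 1ℚ ≋ num x
  +0ˡ x = P.trans (+-cong (P.zeroˡ _) (P.*-identityʳ _)) (+-identity _)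

  -x+x : ∀ x → :- num x :* den x :+ num x :* den x ≋ con 0ℚ
  -x+x x = P.trans (P.+-congʳ (P.sym (P.-‿distribˡ-* _ _))) (+-inverse _)

  zero-num : ∀ {p q} → p ≋ con 0ℚ → p :* con 1ℚ ≋ con 0ℚ :* q
  zero-num e = P.trans (P.*-congʳ e) (P.trans (P.zeroˡ _) (P.sym (P.zeroˡ _)))

inverse : ∀ x → ¬ x ≃ ι (con 0ℚ) → ∃ λ y → (x *ᶠ y) ≃ ι (con 1ℚ)
inverse x x≄0 = [ den x / num x ] {num≉0} ,
  Id.ᶠ-inverse (num x) (den x) (con 1ℚ)
  where
  num≉0 : num x ≉ con 0ℚ
  num≉0 e = x≄0 (P.trans (P.*-congʳ e) (P.trans (P.zeroˡ _) (P.sym (P.zeroˡ _))))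

-- D_b(μ; a, b) is not the zero polynomial: at the point where μ(b − 1) = 1 and
-- the other variables vanish, the matrix is an antidiagonal permutation matrix.

open Determinants ℚ[x] using (Matrix; det; D) public
open import Algebra.Properties.Semiring.Sum P.semiring using (sum)
open import Algebra.Properties.Semiring.Exp P.semiring using (_^_)

module _ (ρ : ℕ → ℚ) where

  private
    sum-last : ∀ n (f : Fin (suc n) → Poly) → (∀ i → ⟦ f (inject₁ i) ⟧ ρ ≡ 0ℚ) →
               ⟦ sum f ⟧ ρ ≡ ⟦ f (fromℕ n) ⟧ ρ
    sum-last zero    f z = ℚ.+-identityʳ _
    sum-last (suc n) f z = ≡.trans
      (≡.cong₂ ℚ._+_ (z fzero) (sum-last n (λ i → f (fsuc i)) (λ i → z (fsuc i))))
      (ℚ.+-identityˡ _)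

    *-≢0 : ∀ {a b} → a ≢ 0ℚ → b ≢ 0ℚ → a ℚ.* b ≢ 0ℚ
    *-≢0 {a} {b} a≢0 b≢0 e with ℚ-integral a b e
    ... | inj₁ a≡0 = a≢0 a≡0
    ... | inj₂ b≡0 = b≢0 b≡0

    sign≢0 : ∀ k → ⟦ (:- con 1ℚ) ^ k ⟧ ρ ≢ 0ℚ
    sign≢0 zero    ()
    sign≢0 (suc k) = *-≢0 {ℚ.- 1ℚ} (λ ()) (sign≢0 k)

    punchIn-last : ∀ n (c : Fin n) → toℕ (punchIn (fromℕ n) c) ≡ toℕ c
    punchIn-last (suc n) fzero    = ≡.refl
    punchIn-last (suc n) (fsuc c) = ≡.cong suc (punchIn-last n c)

  antidiagonal : ∀ n (A : Matrix n) →
    (∀ r c → suc (toℕ r ℕ.+ toℕ c) < n → ⟦ A r c ⟧ ρ ≡ 0ℚ) →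
    (∀ r c → suc (toℕ r ℕ.+ toℕ c) ≡ n → ⟦ A r c ⟧ ρ ≢ 0ℚ) →
    ⟦ det A ⟧ ρ ≢ 0ℚ
  antidiagonal zero    A z u ()
  antidiagonal (suc n) A z u e = *-≢0 (sign≢0 (toℕ (fromℕ n))) (*-≢0 corner minor)
    (≡.trans (≡.sym (sum-last n term vanish)) e)
    where
    B : Fin (suc n) → Matrix n
    B c r d = A (fsuc r) (punchIn c d)

    term : Fin (suc n) → Poly
    term c = (:- con 1ℚ) ^ toℕ c :* (A fzero c :* det (B c))

    vanish : ∀ i → ⟦ term (inject₁ i) ⟧ ρ ≡ 0ℚ
    vanish i = ≡.trans
      (≡.cong (⟦ (:- con 1ℚ) ^ toℕ (inject₁ i) ⟧ ρ ℚ.*_) (≡.trans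
        (≡.cong (ℚ._* ⟦ det (B (inject₁ i)) ⟧ ρ)
          (z fzero (inject₁ i) (s≤s (≡.subst (_< n) (≡.sym (Fin.toℕ-inject₁ i)) (Fin.toℕ<n i)))))
        (ℚ.*-zeroˡ (⟦ det (B (inject₁ i)) ⟧ ρ))))
      (ℚ.*-zeroʳ (⟦ (:- con 1ℚ) ^ toℕ (inject₁ i) ⟧ ρ))

    corner : ⟦ A fzero (fromℕ n) ⟧ ρ ≢ 0ℚ
    corner = u fzero (fromℕ n) (≡.cong suc (Fin.toℕ-fromℕ n))

    index : ∀ (r c : Fin n) → suc (toℕ (fsuc r) ℕ.+ toℕ (punchIn (fromℕ n) c)) ≡ suc (suc (toℕ r ℕ.+ toℕ c))
    index r c = ≡.cong (λ k → suc (suc (toℕ r ℕ.+ k))) (punchIn-last n c)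

    minor : ⟦ det (B (fromℕ n)) ⟧ ρ ≢ 0ℚ
    minor = antidiagonal n (B (fromℕ n))
      (λ r c lt → z (fsuc r) _ (≡.subst (_< suc n) (≡.sym (index r c)) (s≤s lt)))
      (λ r c eq → u (fsuc r) _ (≡.trans (index r c) (≡.cong suc eq)))

T⇒≡true : ∀ {x} → T x → x ≡ true
T⇒≡true {true} _ = ≡.refl

skip-below : ∀ {j k} → k < j → skip j k ≡ k
skip-below {j} {k} lt rewrite T⇒≡true (ℕ.<⇒<ᵇ lt) = ≡.refl

D-last≉0 : ∀ a b → a ≤ b → D var a b b ≉ con 0ℚ
D-last≉0 a b a≤b
  rewrite T⇒≡true (ℕ.≤⇒≤ᵇ a≤b) | T⇒≡true (ℕ.≤⇒≤ᵇ (ℕ.≤-refl {b})) =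
  λ e → antidiagonal ρ n A vanishes is-one (⟦⟧-cong e ρ)
  where
  n = b ∸ a

  A : Matrix n
  A r c = var (skip b (a ℕ.+ toℕ c) ℕ.+ toℕ r)

  ρ : ℕ → ℚ
  ρ k = if suc k ℕ.≡ᵇ b then 1ℚ else 0ℚ

  index : ∀ (r c : Fin n) →
          suc (skip b (a ℕ.+ toℕ c) ℕ.+ toℕ r) ≡ a ℕ.+ suc (toℕ r ℕ.+ toℕ c)
  index r c = begin′
    suc (skip b (a ℕ.+ toℕ c) ℕ.+ toℕ r)
      ≡⟨ ≡.cong (λ k → suc (k ℕ.+ toℕ r)) (skip-below a+c<b) ⟩
    suc (a ℕ.+ toℕ c ℕ.+ toℕ r)
      ≡⟨ ≡.cong suc (ℕ.+-assoc a (toℕ c) (toℕ r)) ⟩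
    suc (a ℕ.+ (toℕ c ℕ.+ toℕ r))
      ≡⟨ ℕ.+-suc a (toℕ c ℕ.+ toℕ r) ⟨
    a ℕ.+ suc (toℕ c ℕ.+ toℕ r)
      ≡⟨ ≡.cong (λ k → a ℕ.+ suc k) (ℕ.+-comm (toℕ c) (toℕ r)) ⟩
    a ℕ.+ suc (toℕ r ℕ.+ toℕ c) ∎′
    where
    open ≡.≡-Reasoning using (step-≡-⟩; step-≡-⟨) renaming (begin_ to begin′_; _∎ to _∎′)
    a+c<b : a ℕ.+ toℕ c < b
    a+c<b = ≡.subst (a ℕ.+ toℕ c <_) (ℕ.m+[n∸m]≡n a≤b) (ℕ.+-monoʳ-< a (Fin.toℕ<n c))

  vanishes : ∀ r c → suc (toℕ r ℕ.+ toℕ c) < n → ⟦ A r c ⟧ ρ ≡ 0ℚ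
  vanishes r c lt with suc (skip b (a ℕ.+ toℕ c) ℕ.+ toℕ r) ℕ.≡ᵇ b in eq
  ... | false = ≡.refl
  ... | true  = ⊥-elim (ℕ.<⇒≢ below-b
    (≡.trans (≡.sym (index r c)) (ℕ.≡ᵇ⇒≡ _ b (≡.subst T (≡.sym eq) _))))
    where
    below-b : a ℕ.+ suc (toℕ r ℕ.+ toℕ c) < b
    below-b = ≡.subst (a ℕ.+ suc (toℕ r ℕ.+ toℕ c) <_) (ℕ.m+[n∸m]≡n a≤b) (ℕ.+-monoʳ-< a lt)

  is-one : ∀ r c → suc (toℕ r ℕ.+ toℕ c) ≡ n → ⟦ A r c ⟧ ρ ≢ 0ℚ
  is-one r c eq rewrite T⇒≡true (ℕ.≡⇒≡ᵇ _ _
    (≡.trans (index r c) (≡.trans (≡.cong (a ℕ.+_) eq) (ℕ.m+[n∸m]≡n a≤b)))) = λ ()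

μ ν : ℕ → Poly
μ i = var i
ν i = μ (suc i)

open import Algebra.Properties.Monoid.Sum (CommutativeRing.*-monoid ℚ⟨x⟩)
  using () renaming (sum to product)

infixl 10 ∏-syntax

∏-syntax : ∀ n → (Fin n → Fraction) → Fraction
∏-syntax _ = product

syntax ∏-syntax n (λ i → x) = ∏[ i < n ] x

{-# OPTIONS --safe #-}

-- Up to the signs (−1)ʲ, the D_j(μ; 0, N) are the coefficients of the N-th
-- orthogonal polynomial p_N of the functional xᵏ ↦ μ(k); let q_N be the
-- analogue for ν.  Then x q_N has degree N + 1, is orthogonal to degree < N
-- for μ, and vanishes at 0, so it is a combination of p_N and p_{N+1}:
--
--   D_{N+1}(μ;0,N+1) D_j(ν;0,N)
--     = D_0(μ;0,N) D_{j+1}(μ;0,N+1) − D_0(μ;0,N+1) D_{j+1}(μ;0,N).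
--
-- Combining each row of the determinant with the preceding one accordingly
-- clears the first column below its top entry and leaves multiples of the rows
-- of the determinant for ν.  The scalars that appear are the numerators and
-- denominators of the product, as D_0(μ;0,N) = D_{N+1}(μ;1,N+1).

module Submission where

open import Algebra.Bundles using (CommutativeRing)
open import Data.Bool using (T; true; false)
open import Data.Empty using (⊥-elim)
open import Data.Fin using (Fin; toℕ; punchIn) renaming (zero to fzero; suc to fsuc)
import Data.Fin.Properties as Fin
open import Data.Nat using (ℕ; zero; suc; _+_; _∸_; _≤_; _<_; _<ᵇ_; _≤ᵇ_; s≤s; z≤n)
import Data.Nat.Properties as ℕ
open import Data.Sum using (inj₁; inj₂)
open import Function using (_∘_; const; id)
open import Relation.Binary.PropositionalEquality as ≡ using (_≡_)
open import Relation.Binary.Definitions using (tri<; tri≈; tri>)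
import Relation.Binary.Reasoning.Setoid
open import Defs using (det; D; μ; ν; D-last≉0; ι; [_/_]; _≃_; _*ᶠ_; ∏-syntax)
open import Data.Rational using (0ℚ)
open import Defs using (skip; skip-below; T⇒≡true; module Determinants)

-- Increasing enumerations and adjacent transpositions of indices.

skip-suc : ∀ j k → skip (suc j) (suc k) ≡ suc (skip j k)
skip-suc j k with k <ᵇ j
... | true  = ≡.refl
... | false = ≡.refl

skip-above : ∀ {j k} → j ≤ k → skip j k ≡ suc k
skip-above {zero}          z≤n     = ≡.refl
skip-above {suc j} {suc k} (s≤s p) = ≡.trans (skip-suc j k) (≡.cong suc (skip-above p))

-- Both sides enumerate in increasing order the numbers other than `j` and `k + 1`; this is the
-- simplicial identity for coface maps.
skip-skip : ∀ {j k} → j ≤ k → ∀ i → skip j (skip k i) ≡ skip (suc k) (skip j i)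
skip-skip {zero}  {k}     z≤n     i       = ≡.sym (skip-suc k i)
skip-skip {suc j} {suc k} (s≤s p) zero    = ≡.refl
skip-skip {suc j} {suc k} (s≤s p) (suc i)
  rewrite skip-suc k i | skip-suc j (skip k i) | skip-suc j i | skip-suc (suc k) (skip j i) =
  ≡.cong suc (skip-skip p i)

toℕ-punchIn : ∀ {n} (j : Fin (suc n)) k → toℕ (punchIn j k) ≡ skip (toℕ j) (toℕ k)
toℕ-punchIn fzero    k        = ≡.refl
toℕ-punchIn (fsuc j) fzero    = ≡.refl
toℕ-punchIn (fsuc j) (fsuc k) =
  ≡.trans (≡.cong suc (toℕ-punchIn j k)) (≡.sym (skip-suc (toℕ j) (toℕ k)))

swap : ℕ → ℕ → ℕ
swap zero    zero          = 1
swap zero    (suc zero)    = 0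
swap zero    (suc (suc i)) = suc (suc i)
swap (suc k) zero          = 0
swap (suc k) (suc i)       = suc (swap k i)

swap-k : ∀ k → swap k k ≡ suc k
swap-k zero    = ≡.refl
swap-k (suc k) = ≡.cong suc (swap-k k)

-- On the numbers other than `k`, exchanging `k` and `k + 1` only moves `k + 1` down to `k`, so it
-- preserves the order.
swap-skip : ∀ k i → swap k (skip k i) ≡ skip (suc k) i
swap-skip zero    zero    = ≡.refl
swap-skip zero    (suc i) = ≡.refl
swap-skip (suc k) zero    = ≡.refl
swap-skip (suc k) (suc i) rewrite skip-suc k i | skip-suc (suc k) i = ≡.cong suc (swap-skip k i)

infixr 5 _◂_

-- Used to select rows: `A ∘ (k ◂ skip k)` is `A` with row `k` moved to the top.
_◂_ : ℕ → (ℕ → ℕ) → ℕ → ℕ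
(a ◂ f) zero    = a
(a ◂ f) (suc i) = f i

-- Signs in a commutative ring.

module Theory {c ℓ} (R : CommutativeRing c ℓ) where

  open CommutativeRing R hiding (zero) renaming (_+_ to infixl 6 _⊹_; _*_ to infixl 7 _·_)
  open import Algebra.Properties.Ring ring using (-1*x≈-x; -‿involutive)
  open import Algebra.Properties.Semiring.Sum semiring
    using (sum; sum-cong-≋; sum-replicate-zero; ∑-distrib-+; ∑-comm; *-distribˡ-sum)
  open import Algebra.Properties.Monoid.Sum *-monoid using () renaming (sum to product; sum-cong-≋ to product-cong)
  open import Algebra.Properties.Semiring.Exp semiring using (_^_)
  open import Algebra.Solver.Ring.NaturalCoefficients.Default commutativeSemiring
    using (solve; _:=_; _:+_; _:*_; con)
  open Relation.Binary.Reasoning.Setoid setoid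
  private module Dt = Determinants R

  -- Subtraction is written as adding a multiple of `-1#`, so that signed identities become semiring
  -- identities with `-1#` as an atom.
  -1# : Carrier
  -1# = - 1#

  sgn : ℕ → Carrier
  sgn k = -1# ^ k

  -1·-1≈1 : -1# · -1# ≈ 1#
  -1·-1≈1 = trans (-1*x≈-x -1#) (-‿involutive 1#)

  cancel : ∀ x → x ⊹ -1# · x ≈ 0#
  cancel x = trans (+-congˡ (-1*x≈-x x)) (-‿inverseʳ x)

  ·-zero : ∀ x {y} → y ≈ 0# → x · y ≈ 0#
  ·-zero x p = trans (*-congˡ p) (zeroʳ x)

  solve-neg : ∀ {x y} → x ⊹ -1# · y ≈ 0# → x ≈ y
  solve-neg {x} {y} p = begin
    x                          ≈⟨ +-identityʳ x ⟨
    x ⊹ 0#                     ≈⟨ +-congˡ (cancel y) ⟨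
    x ⊹ (y ⊹ -1# · y)          ≈⟨ solve 3 (λ a b d → a :+ (b :+ d) := (a :+ d) :+ b) refl x y _ ⟩
    (x ⊹ -1# · y) ⊹ y          ≈⟨ +-congʳ p ⟩
    0# ⊹ y                     ≈⟨ +-identityˡ y ⟩
    y                          ∎

  sgn² : ∀ k → sgn k · sgn k ≈ 1#
  sgn² zero    = *-identityˡ 1#
  sgn² (suc k) = begin
    (-1# · sgn k) · (-1# · sgn k)  ≈⟨ solve 2 (λ e s → (e :* s) :* (e :* s) := (e :* e) :* (s :* s)) refl -1# (sgn k) ⟩
    (-1# · -1#) · (sgn k · sgn k)  ≈⟨ *-cong -1·-1≈1 (sgn² k) ⟩
    1# · 1#                        ≈⟨ *-identityˡ 1# ⟩
    1#                             ∎

  sgn-cancel : ∀ k x → sgn k · x ≈ 0# → x ≈ 0#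
  sgn-cancel k x p = begin
    x                    ≈⟨ *-identityˡ x ⟨
    1# · x               ≈⟨ *-congʳ (sgn² k) ⟨
    sgn k · sgn k · x    ≈⟨ *-assoc _ _ _ ⟩
    sgn k · (sgn k · x)  ≈⟨ *-congˡ p ⟩
    sgn k · 0#           ≈⟨ zeroʳ _ ⟩
    0#                   ∎

  -- Finite sums indexed by natural numbers.

  Sum Prod : ℕ → (ℕ → Carrier) → Carrier
  Sum  n f = sum {n} (λ i → f (toℕ i))
  Prod n f = product {n} (λ i → f (toℕ i))

  Sum-cong : ∀ n {f g} → (∀ i → i < n → f i ≈ g i) → Sum n f ≈ Sum n g
  Sum-cong n p = sum-cong-≋ {n} (λ i → p (toℕ i) (Fin.toℕ<n i))

  Sum-zero : ∀ n {f} → (∀ i → i < n → f i ≈ 0#) → Sum n f ≈ 0#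
  Sum-zero n p = trans (Sum-cong n {g = const 0#} p) (sum-replicate-zero n)

  Sum-+ : ∀ n f g → Sum n (λ i → f i ⊹ g i) ≈ Sum n f ⊹ Sum n g
  Sum-+ n f g = ∑-distrib-+ {n} (f ∘ toℕ) (g ∘ toℕ)

  Sum-* : ∀ n x f → x · Sum n f ≈ Sum n (λ i → x · f i)
  Sum-* n x f = *-distribˡ-sum {n} x (f ∘ toℕ)

  Sum-comm : ∀ m n (f : ℕ → ℕ → Carrier) →
             Sum m (λ i → Sum n (f i)) ≈ Sum n (λ j → Sum m (λ i → f i j))
  Sum-comm m n f = ∑-comm {m} {n} (λ i j → f (toℕ i) (toℕ j))

  Sum-last : ∀ n f → Sum (suc n) f ≈ Sum n f ⊹ f n
  Sum-last zero    f = +-comm (f 0) 0#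
  Sum-last (suc n) f = trans (+-congˡ (Sum-last n (f ∘ suc))) (sym (+-assoc _ _ _))

  Sum-skip : ∀ n f k → k ≤ n → Sum (suc n) f ≈ f k ⊹ Sum n (f ∘ skip k)
  Sum-skip n       f zero    _       = refl
  Sum-skip (suc n) f (suc k) (s≤s p) = begin
    f 0 ⊹ Sum (suc n) (f ∘ suc)
      ≈⟨ +-congˡ (Sum-skip n (f ∘ suc) k p) ⟩
    f 0 ⊹ (f (suc k) ⊹ Sum n (f ∘ suc ∘ skip k))
      ≈⟨ solve 3 (λ a b d → a :+ (b :+ d) := b :+ (a :+ d)) refl (f 0) (f (suc k)) _ ⟩
    f (suc k) ⊹ (f 0 ⊹ Sum n (f ∘ suc ∘ skip k))
      ≈⟨ +-congˡ (+-congˡ (Sum-cong n (λ i _ → reflexive (≡.cong f (≡.sym (skip-suc k i)))))) ⟩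
    f (suc k) ⊹ (f 0 ⊹ Sum n (f ∘ skip (suc k) ∘ suc)) ∎

  -- The indices `c`, `d` stand for the ordered pair of distinct columns `c` and `skip c d`. The
  -- hypothesis cancels the pair `(c, d + 1)` against its reversal, and each induction step removes
  -- the pairs that involve 0.
  Sum-antisymmetric : ∀ n (F : ℕ → ℕ → Carrier) →
    (∀ c d → c ≤ d → F c d ⊹ F (suc d) c ≈ 0#) →
    Sum (suc n) (λ c → Sum n (F c)) ≈ 0#
  Sum-antisymmetric zero    F p = +-identityˡ 0#
  Sum-antisymmetric (suc n) F p = begin
    Sum (suc n) (F 0) ⊹ Sum (suc n) (λ c → F (suc c) 0 ⊹ Sum n (F (suc c) ∘ suc))
      ≈⟨ +-congˡ (Sum-+ (suc n) (λ c → F (suc c) 0) (λ c → Sum n (F (suc c) ∘ suc))) ⟩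
    Sum (suc n) (F 0) ⊹ (Sum (suc n) (λ c → F (suc c) 0) ⊹ Sum (suc n) (λ c → Sum n (F (suc c) ∘ suc)))
      ≈⟨ +-congˡ (+-congˡ (Sum-antisymmetric n (λ c d → F (suc c) (suc d)) (λ c d q → p (suc c) (suc d) (s≤s q)))) ⟩
    Sum (suc n) (F 0) ⊹ (Sum (suc n) (λ c → F (suc c) 0) ⊹ 0#)
      ≈⟨ +-congˡ (+-identityʳ _) ⟩
    Sum (suc n) (F 0) ⊹ Sum (suc n) (λ c → F (suc c) 0)
      ≈⟨ Sum-+ (suc n) (F 0) (λ c → F (suc c) 0) ⟨
    Sum (suc n) (λ c → F 0 c ⊹ F (suc c) 0)
      ≈⟨ Sum-zero (suc n) (λ c _ → p 0 c z≤n) ⟩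
    0# ∎

  -- Determinants of arrays: expansion and linearity in the top two rows.

  -- Infinite arrays, of which `detℕ` reads only a corner, make every change of rows or columns a
  -- composition with a map of `ℕ`.
  Array : Set c
  Array = ℕ → ℕ → Carrier

  detℕ : ℕ → Array → Carrier
  detℕ n A = Dt.det {n} (λ i j → A (toℕ i) (toℕ j))

  det-cong : ∀ {n} {A B : Dt.Matrix n} → (∀ i j → A i j ≈ B i j) → Dt.det A ≈ Dt.det B
  det-cong {zero}  p = refl
  det-cong {suc n} p = sum-cong-≋ {suc n} λ k →
    *-congˡ {x = sgn (toℕ k)} (*-cong (p fzero k) (det-cong (λ i j → p (fsuc i) (punchIn k j))))

  detℕ-cong : ∀ n {A B : Array} → (∀ i j → i < n → j < n → A i j ≈ B i j) → detℕ n A ≈ detℕ n B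
  detℕ-cong n p = det-cong {n} (λ i j → p (toℕ i) (toℕ j) (Fin.toℕ<n i) (Fin.toℕ<n j))

  minor : ℕ → Array → Array
  minor k A i j = A (suc i) (skip k j)

  expand : ∀ n A → detℕ (suc n) A ≈ Sum (suc n) (λ k → sgn k · (A 0 k · detℕ n (minor k A)))
  expand n A = sum-cong-≋ {suc n} λ k → *-congˡ {x = sgn (toℕ k)} (*-congˡ {x = A 0 (toℕ k)} (det-cong {n} (λ i j →
    reflexive (≡.cong (A (suc (toℕ i))) (toℕ-punchIn k j)))))

  det-linear₀ : ∀ n x y {A B C : Array} →
    (∀ j → A 0 j ≈ x · B 0 j ⊹ y · C 0 j) →
    (∀ i j → A (suc i) j ≈ B (suc i) j) → (∀ i j → A (suc i) j ≈ C (suc i) j) →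
    detℕ (suc n) A ≈ x · detℕ (suc n) B ⊹ y · detℕ (suc n) C
  det-linear₀ n x y {A} {B} {C} p q r = begin
    detℕ (suc n) A
      ≈⟨ expand n A ⟩
    Sum (suc n) (term A)
      ≈⟨ Sum-cong (suc n) (λ k _ → step k) ⟩
    Sum (suc n) (λ k → x · term B k ⊹ y · term C k)
      ≈⟨ Sum-+ (suc n) (λ k → x · term B k) (λ k → y · term C k) ⟩
    Sum (suc n) (λ k → x · term B k) ⊹ Sum (suc n) (λ k → y · term C k)
      ≈⟨ +-cong (Sum-* (suc n) x (term B)) (Sum-* (suc n) y (term C)) ⟨
    x · Sum (suc n) (term B) ⊹ y · Sum (suc n) (term C)
      ≈⟨ +-cong (*-congˡ (expand n B)) (*-congˡ (expand n C)) ⟨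
    x · detℕ (suc n) B ⊹ y · detℕ (suc n) C ∎
    where
    term : Array → ℕ → Carrier
    term M k = sgn k · (M 0 k · detℕ n (minor k M))

    step : ∀ k → term A k ≈ x · term B k ⊹ y · term C k
    step k = begin
      sgn k · (A 0 k · a)
        ≈⟨ *-congˡ (*-congʳ (p k)) ⟩
      sgn k · ((x · B 0 k ⊹ y · C 0 k) · a)
        ≈⟨ solve 6 (λ s x y b d a → s :* ((x :* b :+ y :* d) :* a) := x :* (s :* (b :* a)) :+ y :* (s :* (d :* a)))
             refl (sgn k) x y (B 0 k) (C 0 k) a ⟩
      x · (sgn k · (B 0 k · a)) ⊹ y · (sgn k · (C 0 k · a))
        ≈⟨ +-cong (*-congˡ (*-congˡ (*-congˡ (detℕ-cong n (λ i j _ _ → q i (skip k j))))))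
                  (*-congˡ (*-congˡ (*-congˡ (detℕ-cong n (λ i j _ _ → r i (skip k j)))))) ⟩
      x · term B k ⊹ y · term C k ∎
      where a = detℕ n (minor k A)

  -- Row 1 is the top row of every minor along row 0, where `det-linear₀` applies.
  det-linear₁ : ∀ n x y {A B C : Array} →
    (∀ j → A 0 j ≈ B 0 j) → (∀ j → A 0 j ≈ C 0 j) →
    (∀ j → A 1 j ≈ x · B 1 j ⊹ y · C 1 j) →
    (∀ i j → A (suc (suc i)) j ≈ B (suc (suc i)) j) → (∀ i j → A (suc (suc i)) j ≈ C (suc (suc i)) j) →
    detℕ (suc (suc n)) A ≈ x · detℕ (suc (suc n)) B ⊹ y · detℕ (suc (suc n)) C
  det-linear₁ n x y {A} {B} {C} p₁ p₂ p q r = begin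
    detℕ (suc (suc n)) A
      ≈⟨ expand (suc n) A ⟩
    Sum (suc (suc n)) (term A)
      ≈⟨ Sum-cong (suc (suc n)) (λ k _ → step k) ⟩
    Sum (suc (suc n)) (λ k → x · term B k ⊹ y · term C k)
      ≈⟨ Sum-+ (suc (suc n)) (λ k → x · term B k) (λ k → y · term C k) ⟩
    Sum (suc (suc n)) (λ k → x · term B k) ⊹ Sum (suc (suc n)) (λ k → y · term C k)
      ≈⟨ +-cong (Sum-* (suc (suc n)) x (term B)) (Sum-* (suc (suc n)) y (term C)) ⟨
    x · Sum (suc (suc n)) (term B) ⊹ y · Sum (suc (suc n)) (term C)
      ≈⟨ +-cong (*-congˡ (expand (suc n) B)) (*-congˡ (expand (suc n) C)) ⟨
    x · detℕ (suc (suc n)) B ⊹ y · detℕ (suc (suc n)) C ∎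
    where
    m : Array → ℕ → Carrier
    m M k = detℕ (suc n) (minor k M)

    term : Array → ℕ → Carrier
    term M k = sgn k · (M 0 k · m M k)

    step : ∀ k → term A k ≈ x · term B k ⊹ y · term C k
    step k = begin
      sgn k · (A 0 k · m A k)
        ≈⟨ *-congˡ (*-congˡ (det-linear₀ n x y {minor k A} {minor k B} {minor k C} (λ j → p (skip k j)) (λ i j → q i (skip k j)) (λ i j → r i (skip k j)))) ⟩
      sgn k · (A 0 k · (x · m B k ⊹ y · m C k))
        ≈⟨ solve 6 (λ s x y b d a → s :* (a :* (x :* b :+ y :* d)) := x :* (s :* (a :* b)) :+ y :* (s :* (a :* d)))
             refl (sgn k) x y (m B k) (m C k) (A 0 k) ⟩
      x · (sgn k · (A 0 k · m B k)) ⊹ y · (sgn k · (A 0 k · m C k))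
        ≈⟨ +-cong (*-congˡ (*-congˡ (*-congʳ (p₁ k)))) (*-congˡ (*-congˡ (*-congʳ (p₂ k)))) ⟩
      x · term B k ⊹ y · term C k ∎

  -- Alternation, row permutations and Cramer's rule.

  -- Term of the expansion along the top two rows in which row 0 uses column `k` and row 1 uses
  -- column `skip k l`.
  term₂ : ℕ → Array → ℕ → ℕ → Carrier
  term₂ n A k l = sgn k · (A 0 k · (sgn l · (A 1 (skip k l) · detℕ n (minor l (minor k A)))))

  expand₂ : ∀ n A → detℕ (suc (suc n)) A ≈ Sum (suc (suc n)) (λ k → Sum (suc n) (term₂ n A k))
  expand₂ n A = trans (expand (suc n) A) (Sum-cong (suc (suc n)) λ k _ → begin
    sgn k · (A 0 k · detℕ (suc n) (minor k A))
      ≈⟨ *-congˡ (*-congˡ (expand n (minor k A))) ⟩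
    sgn k · (A 0 k · Sum (suc n) (s k))
      ≈⟨ *-congˡ (Sum-* (suc n) (A 0 k) (s k)) ⟩
    sgn k · Sum (suc n) (λ l → A 0 k · s k l)
      ≈⟨ Sum-* (suc n) (sgn k) (λ l → A 0 k · s k l) ⟩
    Sum (suc n) (term₂ n A k) ∎)
    where
    s : ℕ → ℕ → Carrier
    s k l = sgn l · (A 1 (skip k l) · detℕ n (minor l (minor k A)))

  -- Deleting columns k ≤ l + 1 one after the other in either order gives the same
  -- minor but opposite signs.
  term₂-swap : ∀ n A k l → k ≤ l → term₂ n A k l ⊹ term₂ n (A ∘ swap 0) (suc l) k ≈ 0#
  term₂-swap n A k l k≤l rewrite skip-above k≤l | skip-below {suc l} {k} (s≤s k≤l) = begin
    sgn k · (a · (sgn l · (b · m))) ⊹ (-1# · sgn l) · (b · (sgn k · (a · m′)))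
      ≈⟨ +-congˡ (*-congˡ (*-congˡ (*-congˡ (*-congˡ m′≈m)))) ⟩
    sgn k · (a · (sgn l · (b · m))) ⊹ (-1# · sgn l) · (b · (sgn k · (a · m)))
      ≈⟨ solve 6 (λ s t e a b m → s :* (a :* (t :* (b :* m))) :+ (e :* t) :* (b :* (s :* (a :* m)))
                    := (s :* (a :* (t :* (b :* m)))) :+ e :* (s :* (a :* (t :* (b :* m)))))
           refl (sgn k) (sgn l) -1# a b m ⟩
    sgn k · (a · (sgn l · (b · m))) ⊹ -1# · (sgn k · (a · (sgn l · (b · m))))
      ≈⟨ cancel _ ⟩
    0# ∎
    where
    a = A 0 k
    b = A 1 (suc l)
    m  = detℕ n (minor l (minor k A))
    m′ = detℕ n (minor k (minor (suc l) (A ∘ swap 0)))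
    m′≈m : m′ ≈ m
    m′≈m = detℕ-cong n (λ i j _ _ → reflexive (≡.cong (A (suc (suc i))) (≡.sym (skip-skip k≤l j))))

  -- Equal top rows give `A` and `A ∘ swap 0` the same terms, so `term₂-swap` cancels them in pairs.
  -- No division by 2 occurs.
  det-alternating₁ : ∀ n A → (∀ j → A 0 j ≈ A 1 j) → detℕ (suc (suc n)) A ≈ 0#
  det-alternating₁ n A p = trans (expand₂ n A) (Sum-antisymmetric (suc n) (term₂ n A) λ k l k≤l →
    trans (+-congˡ (*-congˡ (*-cong (p (suc l)) (*-congˡ (*-congʳ (sym (p (skip (suc l) k))))))))
          (term₂-swap n A k l k≤l))

  -- For the top two rows, the terms of both determinants together cancel in pairs by `term₂-swap`.
  -- A lower transposition acts inside each minor.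
  det-swap : ∀ n k A → suc k < n → detℕ n (A ∘ swap k) ≈ -1# · detℕ n A
  det-swap (suc (suc n)) zero A _ = solve-neg (begin
    detℕ (2 + n) A′ ⊹ -1# · (-1# · detℕ (2 + n) A)
      ≈⟨ +-congˡ (trans (sym (*-assoc _ _ _)) (trans (*-congʳ -1·-1≈1) (*-identityˡ _))) ⟩
    detℕ (2 + n) A′ ⊹ detℕ (2 + n) A
      ≈⟨ trans (+-comm _ _) (+-cong (expand₂ n A) (expand₂ n A′)) ⟩
    S (term₂ n A) ⊹ S (term₂ n A′)
      ≈⟨ Sum-+ (2 + n) (λ k → Sum (suc n) (term₂ n A k)) (λ k → Sum (suc n) (term₂ n A′ k)) ⟨
    Sum (2 + n) (λ k → Sum (suc n) (term₂ n A k) ⊹ Sum (suc n) (term₂ n A′ k))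
      ≈⟨ Sum-cong (2 + n) (λ k _ → Sum-+ (suc n) (term₂ n A k) (term₂ n A′ k)) ⟨
    S F
      ≈⟨ Sum-antisymmetric (suc n) F antisymmetric ⟩
    0# ∎)
    where
    A′ : Array
    A′ = A ∘ swap 0

    S : Array → Carrier
    S G = Sum (2 + n) (λ k → Sum (suc n) (G k))

    F : Array
    F k l = term₂ n A k l ⊹ term₂ n A′ k l

    antisymmetric : ∀ k l → k ≤ l → F k l ⊹ F (suc l) k ≈ 0#
    antisymmetric k l k≤l = begin
      (term₂ n A k l ⊹ term₂ n A′ k l) ⊹ (term₂ n A (suc l) k ⊹ term₂ n A′ (suc l) k)
        ≈⟨ solve 4 (λ a b d e → (a :+ b) :+ (d :+ e) := (a :+ e) :+ (b :+ d)) refl _ _ _ _ ⟩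
      (term₂ n A k l ⊹ term₂ n A′ (suc l) k) ⊹ (term₂ n A′ k l ⊹ term₂ n A (suc l) k)
        -- `swap 0` undoes itself on each row index read by `term₂`, so `A′ ∘ swap 0` serves as `A`.
        ≈⟨ +-cong (term₂-swap n A k l k≤l) (term₂-swap n A′ k l k≤l) ⟩
      0# ⊹ 0#
        ≈⟨ +-identityˡ 0# ⟩
      0# ∎
  det-swap (suc n) (suc k) A (s≤s k<n) = begin
    detℕ (suc n) (A ∘ swap (suc k))
      ≈⟨ expand n (A ∘ swap (suc k)) ⟩
    Sum (suc n) (λ c → sgn c · (A 0 c · detℕ n (minor c A ∘ swap k)))
      ≈⟨ Sum-cong (suc n) (λ c _ → trans (*-congˡ (*-congˡ (det-swap n k (minor c A) k<n)))
           (solve 4 (λ s a e m → s :* (a :* (e :* m)) := e :* (s :* (a :* m))) refl (sgn c) (A 0 c) -1# _)) ⟩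
    Sum (suc n) (λ c → -1# · (sgn c · (A 0 c · detℕ n (minor c A))))
      ≈⟨ Sum-* (suc n) -1# (λ c → sgn c · (A 0 c · detℕ n (minor c A))) ⟨
    -1# · Sum (suc n) (λ c → sgn c · (A 0 c · detℕ n (minor c A)))
      ≈⟨ *-congˡ (expand n A) ⟨
    -1# · detℕ (suc n) A ∎

  -- Adjacent swaps raise the repeated row until it lies just below row 0; each one changes only the
  -- sign.
  det-alternating : ∀ n r A → r < n → (∀ j → A 0 j ≈ A (suc r) j) → detℕ (suc n) A ≈ 0#
  det-alternating (suc n) zero    A _   p = det-alternating₁ n A p
  det-alternating (suc n) (suc r) A r<n p = sgn-cancel 1 _ (begin
    sgn 1 · detℕ (2 + n) A       ≈⟨ *-congʳ (*-identityʳ -1#) ⟩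
    -1# · detℕ (2 + n) A         ≈⟨ det-swap (2 + n) (suc r) A (s≤s r<n) ⟨
    detℕ (2 + n) (A ∘ swap (suc r))
      ≈⟨ det-alternating (suc n) r (A ∘ swap (suc r)) (ℕ.<-trans (ℕ.n<1+n r) r<n)
           (λ j → trans (p j) (reflexive (≡.cong (λ i → A (suc i) j) (≡.sym (swap-k r))))) ⟩
    0# ∎)

  -- The cycle that brings row `k` to the top is a product of `k` adjacent transpositions.
  det-front : ∀ n k A → k < n → detℕ n (A ∘ (k ◂ skip k)) ≈ sgn k · detℕ n A
  det-front n zero A _ = trans
    (detℕ-cong n {A ∘ (0 ◂ suc)} {A} (λ { zero j _ _ → refl ; (suc i) j _ _ → refl })) (sym (*-identityˡ _))
  det-front n (suc k) A k<n = begin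
    detℕ n (A ∘ (suc k ◂ skip (suc k)))
      ≈⟨ detℕ-cong n {A ∘ (suc k ◂ skip (suc k))} {A ∘ swap k ∘ (k ◂ skip k)}
           (λ { zero    j _ _ → reflexive (≡.cong (λ i → A i j) (≡.sym (swap-k k)))
                        ; (suc i) j _ _ → reflexive (≡.cong (λ i → A i j) (≡.sym (swap-skip k i))) }) ⟩
    detℕ n (A ∘ swap k ∘ (k ◂ skip k))
      ≈⟨ det-front n k (A ∘ swap k) (ℕ.<-trans (ℕ.n<1+n k) k<n) ⟩
    sgn k · detℕ n (A ∘ swap k)
      ≈⟨ *-congˡ (det-swap n k A k<n) ⟩
    sgn k · (-1# · detℕ n A)
      ≈⟨ solve 3 (λ s e d → s :* (e :* d) := (e :* s) :* d) refl (sgn k) -1# _ ⟩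
    sgn (suc k) · detℕ n A ∎

  -- Cramer's rule with rows: Φ r is the determinant with row k moved to the front
  -- and then replaced by row r, so v k · Φ k = Φ(Σ v r · row r) = 0.
  row-kernel : ∀ n (v : ℕ → Carrier) A →
    (∀ c → c < n → Sum n (λ r → v r · A r c) ≈ 0#) →
    ∀ k → k < n → v k · detℕ n A ≈ 0#
  row-kernel (suc n) v A p k (s≤s k≤n) = sgn-cancel k _ (begin
    sgn k · (v k · detℕ (suc n) A)
      ≈⟨ solve 3 (λ s x d → s :* (x :* d) := x :* (s :* d)) refl (sgn k) (v k) _ ⟩
    v k · (sgn k · detℕ (suc n) A)
      ≈⟨ *-congˡ (det-front (suc n) k A (s≤s k≤n)) ⟨
    v k · detℕ (suc n) (A ∘ (k ◂ skip k))
      ≈⟨ *-congˡ (expand n (A ∘ (k ◂ skip k))) ⟩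
    v k · Φ k
      ≈⟨ +-identityʳ _ ⟨
    v k · Φ k ⊹ 0#
      ≈⟨ +-congˡ (Sum-zero n (λ i i<n → ·-zero (v (skip k i)) (Φ-skip i i<n))) ⟨
    v k · Φ k ⊹ Sum n (λ i → v (skip k i) · Φ (skip k i))
      ≈⟨ Sum-skip n (λ r → v r · Φ r) k k≤n ⟨
    Sum (suc n) (λ r → v r · Φ r)
      ≈⟨ Sum-cong (suc n) (λ r _ → Sum-* (suc n) (v r) (λ c → sgn c · (A r c · C c))) ⟩
    Sum (suc n) (λ r → Sum (suc n) (λ c → v r · (sgn c · (A r c · C c))))
      ≈⟨ Sum-comm (suc n) (suc n) (λ r c → v r · (sgn c · (A r c · C c))) ⟩
    Sum (suc n) (λ c → Sum (suc n) (λ r → v r · (sgn c · (A r c · C c))))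
      ≈⟨ Sum-zero (suc n) column ⟩
    0# ∎)
    where
    C : ℕ → Carrier
    C c = detℕ n (λ i j → A (skip k i) (skip c j))

    Φ : ℕ → Carrier
    Φ r = Sum (suc n) (λ c → sgn c · (A r c · C c))

    -- Row `skip k i` occurs both at the top and as row `suc i`.
    Φ-skip : ∀ i → i < n → Φ (skip k i) ≈ 0#
    Φ-skip i i<n = trans (sym (expand n (A ∘ (skip k i ◂ skip k))))
      (det-alternating n i (A ∘ (skip k i ◂ skip k)) i<n (λ j → refl))

    column : ∀ c → c < suc n → Sum (suc n) (λ r → v r · (sgn c · (A r c · C c))) ≈ 0#
    column c c<n = begin
      Sum (suc n) (λ r → v r · (sgn c · (A r c · C c)))
        ≈⟨ Sum-cong (suc n) (λ r _ → solve 4 (λ v s a x → v :* (s :* (a :* x)) := (s :* x) :* (v :* a))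
             refl (v r) (sgn c) (A r c) (C c)) ⟩
      Sum (suc n) (λ r → (sgn c · C c) · (v r · A r c))
        ≈⟨ Sum-* (suc n) (sgn c · C c) (λ r → v r · A r c) ⟨
      (sgn c · C c) · Sum (suc n) (λ r → v r · A r c)
        ≈⟨ trans (*-congˡ (p c c<n)) (zeroʳ _) ⟩
      0# ∎

  -- Row operations and zero columns.

  combine : (s t : ℕ → Carrier) → Array → Array
  combine s t A zero    j = A zero j
  combine s t A (suc i) j = s i · A (suc i) j ⊹ t i · A i j

  -- This is left multiplication by a lower bidiagonal matrix with diagonal `1, s 0, s 1, …`. After
  -- splitting row 1, the `t 0` part repeats row 0, and the minors of the `s 0` part are again of
  -- the form `combine`.
  det-combine : ∀ n s t A → detℕ (suc n) (combine s t A) ≈ Prod n s · detℕ (suc n) A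
  det-combine zero s t A = trans
    (detℕ-cong 1 {combine s t A} {A} (λ { zero j _ _ → refl ; (suc i) j (s≤s ()) _ }))
    (sym (*-identityˡ _))
  det-combine (suc n) s t A = begin
    detℕ (2 + n) A′
      ≈⟨ det-linear₁ n (s 0) (t 0) {A′} {B} {C} (λ _ → refl) (λ _ → refl) (λ _ → refl) (λ _ _ → refl) (λ _ _ → refl) ⟩
    s 0 · detℕ (2 + n) B ⊹ t 0 · detℕ (2 + n) C
      ≈⟨ +-congˡ (trans (*-congˡ (det-alternating₁ n C (λ _ → refl))) (zeroʳ _)) ⟩
    s 0 · detℕ (2 + n) B ⊹ 0#
      ≈⟨ +-identityʳ _ ⟩
    s 0 · detℕ (2 + n) B
      ≈⟨ *-congˡ (expand (suc n) B) ⟩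
    s 0 · Sum (2 + n) (λ c → sgn c · (A 0 c · detℕ (suc n) (minor c B)))
      ≈⟨ *-congˡ (Sum-cong (2 + n) (λ c _ → step c)) ⟩
    s 0 · Sum (2 + n) (λ c → Prod n (s ∘ suc) · term c)
      ≈⟨ *-congˡ (Sum-* (2 + n) (Prod n (s ∘ suc)) term) ⟨
    s 0 · (Prod n (s ∘ suc) · Sum (2 + n) term)
      ≈⟨ *-assoc _ _ _ ⟨
    Prod (suc n) s · Sum (2 + n) term
      ≈⟨ *-congˡ (expand (suc n) A) ⟨
    Prod (suc n) s · detℕ (2 + n) A ∎
    where
    A′ B C : Array
    A′ = combine s t A
    B zero          = A 0
    B (suc zero)    = A 1
    B (suc (suc i)) = A′ (suc (suc i))
    C zero          = A 0
    C (suc zero)    = A 0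
    C (suc (suc i)) = A′ (suc (suc i))

    term : ℕ → Carrier
    term c = sgn c · (A 0 c · detℕ (suc n) (minor c A))

    step : ∀ c → sgn c · (A 0 c · detℕ (suc n) (minor c B)) ≈ Prod n (s ∘ suc) · term c
    step c = begin
      sgn c · (A 0 c · detℕ (suc n) (minor c B))
        ≈⟨ *-congˡ (*-congˡ (detℕ-cong (suc n) {minor c B} {combine (s ∘ suc) (t ∘ suc) (minor c A)}
             (λ { zero j _ _ → refl ; (suc i) j _ _ → refl }))) ⟩
      sgn c · (A 0 c · detℕ (suc n) (combine (s ∘ suc) (t ∘ suc) (minor c A)))
        ≈⟨ *-congˡ (*-congˡ (det-combine n (s ∘ suc) (t ∘ suc) (minor c A))) ⟩
      sgn c · (A 0 c · (Prod n (s ∘ suc) · detℕ (suc n) (minor c A)))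
        ≈⟨ solve 4 (λ s a p d → s :* (a :* (p :* d)) := p :* (s :* (a :* d))) refl (sgn c) (A 0 c) (Prod n (s ∘ suc)) _ ⟩
      Prod n (s ∘ suc) · term c ∎

  det-scale : ∀ n s A → detℕ n (λ i j → s i · A i j) ≈ Prod n s · detℕ n A
  det-scale zero    s A = sym (*-identityˡ _)
  det-scale (suc n) s A = begin
    detℕ (suc n) (λ i j → s i · A i j)
      ≈⟨ expand n (λ i j → s i · A i j) ⟩
    Sum (suc n) (λ c → sgn c · ((s 0 · A 0 c) · detℕ n (λ i j → s (suc i) · minor c A i j)))
      ≈⟨ Sum-cong (suc n) (λ c _ → trans (*-congˡ (*-congˡ (det-scale n (s ∘ suc) (minor c A))))
           (solve 5 (λ e x a p d → e :* ((x :* a) :* (p :* d)) := (x :* p) :* (e :* (a :* d)))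
             refl (sgn c) (s 0) (A 0 c) (Prod n (s ∘ suc)) _)) ⟩
    Sum (suc n) (λ c → Prod (suc n) s · (sgn c · (A 0 c · detℕ n (minor c A))))
      ≈⟨ Sum-* (suc n) (Prod (suc n) s) (λ c → sgn c · (A 0 c · detℕ n (minor c A))) ⟨
    Prod (suc n) s · Sum (suc n) (λ c → sgn c · (A 0 c · detℕ n (minor c A)))
      ≈⟨ *-congˡ (expand n A) ⟨
    Prod (suc n) s · detℕ (suc n) A ∎

  mutual

    det-zero-column : ∀ n A → (∀ i → A i 0 ≈ 0#) → detℕ (suc n) A ≈ 0#
    det-zero-column n A p = trans (det-first-column n A (p ∘ suc)) (trans (*-congʳ (p 0)) (zeroˡ _))

    -- Minors along the other columns keep the zero column and vanish by `det-zero-column` one size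
    -- down, which in turn is the case of a zero corner.
    det-first-column : ∀ n A → (∀ i → A (suc i) 0 ≈ 0#) →
      detℕ (suc n) A ≈ A 0 0 · detℕ n (λ i j → A (suc i) (suc j))
    det-first-column n A p = begin
      detℕ (suc n) A
        ≈⟨ expand n A ⟩
      1# · (A 0 0 · detℕ n (minor 0 A)) ⊹ Sum n (λ c → sgn (suc c) · (A 0 (suc c) · detℕ n (minor (suc c) A)))
        ≈⟨ +-cong (*-identityˡ _) (rest n p) ⟩
      A 0 0 · detℕ n (minor 0 A) ⊹ 0#
        ≈⟨ +-identityʳ _ ⟩
      A 0 0 · detℕ n (λ i j → A (suc i) (suc j)) ∎
      where
      rest : ∀ n → (∀ i → A (suc i) 0 ≈ 0#) →
             Sum n (λ c → sgn (suc c) · (A 0 (suc c) · detℕ n (minor (suc c) A))) ≈ 0#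
      rest zero    p = refl
      rest (suc n) p = Sum-zero (suc n) (λ c _ →
        ·-zero (sgn (suc c)) (·-zero (A 0 (suc c)) (det-zero-column n (minor (suc c) A) p)))

  -- The determinants `D` and their orthogonality.

  D-≤ : ∀ (m : ℕ → Carrier) {N j} → j ≤ N → Dt.D m 0 N j ≡ detℕ N (λ r k → m (skip j k + r))
  D-≤ m {N} {j} j≤N rewrite T⇒≡true (ℕ.≤⇒≤ᵇ j≤N) = ≡.refl

  D-> : ∀ (m : ℕ → Carrier) {N j} → N < j → Dt.D m 0 N j ≡ 0#
  D-> m {N} {j} N<j with j ≤ᵇ N in eq
  ... | false = ≡.refl
  ... | true  = ⊥-elim (ℕ.<⇒≱ N<j (ℕ.≤ᵇ⇒≤ j N (≡.subst T (≡.sym eq) _)))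

  hankel : (ℕ → Carrier) → Array
  hankel m r k = m (k + r)

  D-last : ∀ (m : ℕ → Carrier) N → Dt.D m 0 N N ≈ detℕ N (hankel m)
  D-last m N = trans (reflexive (D-≤ m (ℕ.≤-refl {N}))) (detℕ-cong N (λ r k _ k<N →
    reflexive (≡.cong (λ l → m (l + r)) (skip-below k<N))))

  D-shift : ∀ (m : ℕ → Carrier) N → Dt.D m 1 (suc N) (suc N) ≈ detℕ N (hankel (m ∘ suc))
  D-shift m N rewrite T⇒≡true (ℕ.<⇒<ᵇ (ℕ.n<1+n N)) = detℕ-cong N (λ r k _ k<N →
    reflexive (≡.cong (λ l → m (l + r)) (skip-below {suc N} (s≤s k<N))))

  D-first : ∀ (m : ℕ → Carrier) N → Dt.D m 0 N 0 ≈ detℕ N (hankel (m ∘ suc))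
  D-first m N = reflexive (D-≤ m {N} z≤n)

  -- The sum expands, along its top row, the Hankel array with a copy of row `r` placed above rows
  -- `0` to `N − 1`; since `r < N`, that row is repeated.
  orthogonal : ∀ (m : ℕ → Carrier) N r → r < N →
    Sum (suc N) (λ j → sgn j · (m (j + r) · Dt.D m 0 N j)) ≈ 0#
  orthogonal m N r r<N = begin
    Sum (suc N) (λ j → sgn j · (m (j + r) · Dt.D m 0 N j))
      ≈⟨ Sum-cong (suc N) (λ { j (s≤s j≤N) →
           *-congˡ {x = sgn j} (*-congˡ {x = m (j + r)} (reflexive (D-≤ m j≤N))) }) ⟩
    Sum (suc N) (λ j → sgn j · (m (j + r) · detℕ N (λ i k → m (skip j k + i))))
      ≈⟨ expand N (hankel m ∘ (r ◂ id)) ⟨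
    detℕ (suc N) (hankel m ∘ (r ◂ id))
      ≈⟨ det-alternating N r (hankel m ∘ (r ◂ id)) r<N (λ _ → refl) ⟩
    0# ∎

  -- The Christoffel relation between a sequence and its shift.

  module _ (m : ℕ → Carrier) (N : ℕ) where

    private
      α β γ : Carrier
      α = Dt.D m 0 (suc N) (suc N)
      β = Dt.D m 0 N 0
      γ = Dt.D m 0 (suc N) 0

      q d₀ d₁ e f : ℕ → Carrier
      -- f is, up to a common sign, the coefficient sequence of the difference of
      -- the two sides of the relation between q_N, p_N and p_{N+1}, divided by x.
      q  j = Dt.D (m ∘ suc) 0 N j
      d₀ j = Dt.D m 0 N (suc j)
      d₁ j = Dt.D m 0 (suc N) (suc j)
      e  j = α · q j ⊹ (-1# · β · d₁ j ⊹ γ · d₀ j)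
      f  j = sgn j · e j

      -- All three indices are out of range, where `D` is 0. This case matters because the columns
      -- of the final matrices can exceed the size of a row's determinants.
      e-above : ∀ j → N < j → e j ≈ 0#
      e-above j N<j
        rewrite D-> (m ∘ suc) N<j | D-> m {suc N} (s≤s N<j) | D-> m {N} (ℕ.<-trans N<j (ℕ.n<1+n j)) =
        trans (+-cong (zeroʳ _) (trans (+-cong (zeroʳ _) (zeroʳ _)) (+-identityˡ _))) (+-identityˡ _)

      -- Leading coefficients cancel: `q N` and `β` are the same Hankel determinant of the shifted
      -- sequence, `d₁ N` is `α`, and `d₀ N` is out of range.
      e-top : e N ≈ 0#
      e-top = begin
        α · q N ⊹ (-1# · β · α ⊹ γ · d₀ N)
          ≈⟨ +-cong (*-congˡ (trans (D-last (m ∘ suc) N) (sym (D-first m N))))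
               (trans (+-congˡ (trans (*-congˡ (reflexive (D-> m (ℕ.n<1+n N)))) (zeroʳ _))) (+-identityʳ _)) ⟩
        α · β ⊹ -1# · β · α
          ≈⟨ +-congˡ (solve 3 (λ a b s → s :* b :* a := s :* (a :* b)) refl α β -1#) ⟩
        α · β ⊹ -1# · (α · β)
          ≈⟨ cancel _ ⟩
        0# ∎

      module _ (r : ℕ) (r<N : r < N) where

        s₀ s₁ s₂ : ℕ → Carrier
        s₀ j = sgn j · (m (suc j + r) · d₀ j)
        s₁ j = sgn j · (m (suc j + r) · d₁ j)
        s₂ j = sgn j · (m (suc j + r) · q j)

        S₀ S₁ S₂ : Carrier
        S₀ = Sum (suc N) s₀
        S₁ = Sum (suc N) s₁
        S₂ = Sum (suc N) s₂

        shift : ∀ n (d : ℕ → Carrier) →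
          Sum n (λ j → sgn (suc j) · (m (suc j + r) · d j)) ≈ -1# · Sum n (λ j → sgn j · (m (suc j + r) · d j))
        shift n d = trans (Sum-cong n (λ j _ → *-assoc -1# (sgn j) (m (suc j + r) · d j)))
          (sym (Sum-* n -1# (λ j → sgn j · (m (suc j + r) · d j))))

        -- The term `j = 0` of `orthogonal` is split off; shifting the index of the others costs a
        -- sign.
        orthogonal₁ : m r · γ ⊹ -1# · S₁ ≈ 0#
        orthogonal₁ = trans (+-cong (sym (*-identityˡ (m r · γ))) (sym (shift (suc N) d₁)))
          (orthogonal m (suc N) r (ℕ.<-trans r<N (ℕ.n<1+n N)))

        orthogonal₀ : m r · β ⊹ -1# · S₀ ≈ 0#
        orthogonal₀ = trans (+-cong (sym (*-identityˡ (m r · β))) (trans (*-congˡ last) (sym (shift N d₀))))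
          (orthogonal m N r r<N)
          where
          -- `S₀` has one term more than `orthogonal` supplies, with the out-of-range factor `d₀ N`.
          last : S₀ ≈ Sum N s₀
          last = trans (Sum-last N s₀) (trans (+-congˡ (·-zero (sgn N)
            (·-zero (m (suc N + r)) (reflexive (D-> m (ℕ.n<1+n N)))))) (+-identityʳ _))

        -- `S₂` vanishes by orthogonality for the shifted sequence. Since `S₀` is `m r · β` and `S₁`
        -- is `m r · γ`, the weights `-1# · β` and `γ` make the other two sums cancel.
        f-orthogonal : Sum N (λ j → f j · m (suc j + r)) ≈ 0#
        f-orthogonal = begin
          Sum N (λ j → f j · m (suc j + r))
            -- The vanishing top term is added so that the sums match those in `orthogonal`.
            ≈⟨ trans (Sum-last N (λ j → f j · m (suc j + r)))
                 (trans (+-congˡ (trans (*-congʳ (trans (*-congˡ e-top) (zeroʳ _))) (zeroˡ _))) (+-identityʳ _)) ⟨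
          Sum (suc N) (λ j → f j · m (suc j + r))
            ≈⟨ Sum-cong (suc N) (λ j _ →
                 solve 8 (λ s a q b x c y z → s :* (a :* q :+ (b :* x :+ c :* y)) :* z
                    := a :* (s :* (z :* q)) :+ (b :* (s :* (z :* x)) :+ c :* (s :* (z :* y))))
                 refl (sgn j) α (q j) (-1# · β) (d₁ j) γ (d₀ j) (m (suc j + r))) ⟩
          Sum (suc N) (λ j → α · s₂ j ⊹ (-1# · β · s₁ j ⊹ γ · s₀ j))
            ≈⟨ trans (Sum-+ (suc N) (λ j → α · s₂ j) (λ j → -1# · β · s₁ j ⊹ γ · s₀ j))
                 (+-congˡ (Sum-+ (suc N) (λ j → -1# · β · s₁ j) (λ j → γ · s₀ j))) ⟩
          Sum (suc N) (λ j → α · s₂ j) ⊹ (Sum (suc N) (λ j → -1# · β · s₁ j) ⊹ Sum (suc N) (λ j → γ · s₀ j))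
            ≈⟨ +-cong (Sum-* (suc N) α s₂) (+-cong (Sum-* (suc N) (-1# · β) s₁) (Sum-* (suc N) γ s₀)) ⟨
          α · S₂ ⊹ (-1# · β · S₁ ⊹ γ · S₀)
            ≈⟨ +-cong (trans (*-congˡ (orthogonal (m ∘ suc) N r r<N)) (zeroʳ _)) (+-congˡ
                 (*-congˡ (sym (solve-neg orthogonal₀)))) ⟩
          0# ⊹ (-1# · β · S₁ ⊹ γ · (m r · β))
            ≈⟨ +-identityˡ _ ⟩
          -1# · β · S₁ ⊹ γ · (m r · β)
            ≈⟨ solve 5 (λ s b x c z → s :* b :* x :+ c :* (z :* b) := b :* (z :* c :+ s :* x)) refl -1# β S₁ γ (m r) ⟩
          β · (m r · γ ⊹ -1# · S₁)
            ≈⟨ trans (*-congˡ orthogonal₁) (zeroʳ _) ⟩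
          0# ∎

      -- The first `N` values of `f` form a left kernel vector of an `N` by `N` Hankel matrix, so
      -- `row-kernel` applies to each of them.
      e-kernel : ∀ j → e j · detℕ N (hankel (m ∘ suc)) ≈ 0#
      e-kernel j with ℕ.<-cmp j N
      ... | tri> _ _ N<j = trans (*-congʳ (e-above j N<j)) (zeroˡ _)
      ... | tri≈ _ ≡.refl _ = trans (*-congʳ e-top) (zeroˡ _)
      ... | tri< j<N _ _ = sgn-cancel j _ (trans (sym (*-assoc _ _ _))
        (row-kernel N f (hankel (m ∘ suc))
          -- The Hankel matrix is symmetric, so the orthogonality relations are also its column
          -- equations.
          (λ r r<N → trans (Sum-cong N (λ i _ →
            *-congˡ {x = f i} (reflexive (≡.cong (m ∘ suc) (ℕ.+-comm r i))))) (f-orthogonal r r<N))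
          j j<N))

    christoffel : ∀ j → (Dt.D m 0 (suc N) (suc N) · Dt.D (m ∘ suc) 0 N j
        ⊹ (-1# · Dt.D m 0 N 0 · Dt.D m 0 (suc N) (suc j) ⊹ Dt.D m 0 (suc N) 0 · Dt.D m 0 N (suc j)))
      · detℕ N (hankel (m ∘ suc)) ≈ 0#
    christoffel = e-kernel

  -- The hypothesis stands in for R being a domain and the Hankel determinants
  -- being nonzero.
  module Regular (m : ℕ → Carrier)
    (regular : ∀ N x → x · detℕ N (hankel (m ∘ suc)) ≈ 0# → x ≈ 0#) (l : ℕ) where

    private
      A Q : Array
      A i j = Dt.D m 0 (i + l) j
      Q i j = Dt.D (m ∘ suc) 0 (i + l) j

      -- The multipliers that clear the first column are the coefficients of the Christoffel
      -- relation for `N = i + l`, so the other columns become `α i · Q i j`.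
      s t α : ℕ → Carrier
      s i = A i 0
      t i = -1# · A (suc i) 0
      α i = A (suc i) (suc i + l)

      combine-zero : ∀ i → combine s t A (suc i) 0 ≈ 0#
      combine-zero i = begin
        s i · A (suc i) 0 ⊹ -1# · A (suc i) 0 · A i 0
          ≈⟨ +-congˡ (solve 3 (λ e x y → e :* x :* y := e :* (y :* x)) refl -1# (A (suc i) 0) (A i 0)) ⟩
        s i · A (suc i) 0 ⊹ -1# · (s i · A (suc i) 0)
          ≈⟨ cancel _ ⟩
        0# ∎

      combine-suc : ∀ i j → combine s t A (suc i) (suc j) ≈ α i · Q i j
      combine-suc i j = sym (solve-neg (begin
        α i · Q i j ⊹ -1# · (s i · A (suc i) (suc j) ⊹ -1# · g · A i (suc j))
          ≈⟨ solve 6 (λ z e b x c y → z :+ e :* (b :* x :+ e :* c :* y)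
               := z :+ (e :* b :* x :+ (e :* e) :* (c :* y)))
               refl (α i · Q i j) -1# (s i) (A (suc i) (suc j)) g (A i (suc j)) ⟩
        α i · Q i j ⊹ (-1# · s i · A (suc i) (suc j) ⊹ -1# · -1# · (g · A i (suc j)))
          ≈⟨ +-congˡ (+-congˡ (trans (*-congʳ -1·-1≈1) (*-identityˡ _))) ⟩
        α i · Q i j ⊹ (-1# · s i · A (suc i) (suc j) ⊹ g · A i (suc j))
          ≈⟨ regular (i + l) _ (christoffel m (i + l) j) ⟩
        0# ∎))
        where g = A (suc i) 0

    det-relation : ∀ n →
      Prod n (λ i → Dt.D m 1 (suc i + l) (suc i + l)) · detℕ (suc n) (λ i j → Dt.D m 0 (i + l) j)
      ≈ Dt.D m 0 l 0 · (Prod n (λ i → Dt.D m 0 (suc i + l) (suc i + l)) · detℕ n (λ i j → Dt.D (m ∘ suc) 0 (i + l) j))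
    det-relation n = begin
      Prod n (λ i → Dt.D m 1 (suc i + l) (suc i + l)) · detℕ (suc n) A
        -- The denominators are the row multipliers `s i`: both are Hankel determinants of the
        -- shifted sequence.
        ≈⟨ *-congʳ (product-cong {n} (λ i → trans (D-shift m (toℕ i + l)) (sym (D-first m (toℕ i + l))))) ⟩
      Prod n s · detℕ (suc n) A
        ≈⟨ det-combine n s t A ⟨
      detℕ (suc n) (combine s t A)
        ≈⟨ det-first-column n (combine s t A) combine-zero ⟩
      A 0 0 · detℕ n (λ i j → combine s t A (suc i) (suc j))
        ≈⟨ *-congˡ (detℕ-cong n (λ i j _ _ → combine-suc i j)) ⟩
      A 0 0 · detℕ n (λ i j → α i · Q i j)
        ≈⟨ *-congˡ (det-scale n α Q) ⟩
      A 0 0 · (Prod n α · detℕ n Q) ∎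

  -- The conclusion is what `_≃_` means for `ι d` and `ι a *ᶠ ι q *ᶠ [ u / p ]`; the units are the
  -- denominators of `ι`.
  cross-multiply : ∀ {p d a u q} → p · d ≈ a · (u · q) → d · (1# · 1# · p) ≈ a · q · u · 1#
  cross-multiply {p} {d} {a} {u} {q} h = begin
    d · (1# · 1# · p)  ≈⟨ solve 2 (λ d p → d :* (con 1 :* con 1 :* p) := p :* d) refl d p ⟩
    p · d              ≈⟨ h ⟩
    a · (u · q)        ≈⟨ solve 3 (λ a u q → a :* (u :* q) := a :* q :* u :* con 1) refl a u q ⟩
    a · q · u · 1#     ∎

-- Passage to polynomials and rational functions.

open import Defs using (ℚ[x]; Fraction; _:*_; _≋_; ≋-trans; con; integral)
open Fraction using (num; den)

module Pol where
  open Theory ℚ[x] public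
  open CommutativeRing ℚ[x] using (*-monoid) public
  open import Algebra.Properties.Monoid.Sum *-monoid using () renaming (sum to product) public

num-∏ : ∀ n (f : Fin n → Fraction) → num (∏[ i < n ] f i) ≡ Pol.product (num ∘ f)
num-∏ zero    f = ≡.refl
num-∏ (suc n) f = ≡.cong (num (f fzero) :*_) (num-∏ n (f ∘ fsuc))

den-∏ : ∀ n (f : Fin n → Fraction) → den (∏[ i < n ] f i) ≡ Pol.product (den ∘ f)
den-∏ zero    f = ≡.refl
den-∏ (suc n) f = ≡.cong (den (f fzero) :*_) (den-∏ n (f ∘ fsuc))

-- Polynomials form a domain, and this Hankel determinant is `D μ 1 (suc N) (suc N)`, which is
-- nonzero by `D-last≉0`.
hankel-regular : ∀ N x → x :* Pol.detℕ N (Pol.hankel ν) ≋ con 0ℚ → x ≋ con 0ℚ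
hankel-regular N x e with integral x _ e
... | inj₁ x≋0 = x≋0
... | inj₂ h≋0 = ⊥-elim (D-last≉0 1 (suc N) (s≤s z≤n) (≋-trans (Pol.D-shift μ N) h≋0))

leading-ratio : ℕ → ℕ → Fraction
leading-ratio m i = [ D μ 0 (suc i + m) (suc i + m) / D μ 1 (suc i + m) (suc i + m) ]
  {D-last≉0 1 (suc i + m) (s≤s z≤n)}

theorem1 : ∀ (m n : ℕ) → 1 ≤ n →
    ι (det {n} (λ i j → D μ 0 (toℕ i + m) (toℕ j)))
    ≃ ι (D μ 0 m 0)
    *ᶠ ι (det {n ∸ 1} (λ i j → D ν 0 (toℕ i + m) (toℕ j)))
    *ᶠ ∏[ i < n ∸ 1 ]
    ([ D μ 0 (suc (toℕ i) + m) (suc (toℕ i) + m) / D μ 1 (suc (toℕ i) + m) (suc (toℕ i) + m) ]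
    {D-last≉0 1 (suc (toℕ i) + m) (s≤s z≤n)})
theorem1 m (suc n) _
  rewrite num-∏ n (λ i → leading-ratio m (toℕ i)) | den-∏ n (λ i → leading-ratio m (toℕ i)) =
  Pol.cross-multiply (Pol.Regular.det-relation μ hankel-regular m n)
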